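{- A delta-matroid has a twist of width at most one if and only if it has no minor isomorphic to a member of $\mathcal{D}_{[5]}$, where $\mathcal{D}_{[5]}$ is the set of all twists of the delta-matroids $D_1,\ldots,D_5$ defined as follows. $D_1$ is the delta-matroid on the ground set $\{a,b\}$ with feasible sets $\mathcal{F}(D_1)=\{\emptyset,\{a\},\{b\},\{a,b\}\}$, and $D_2,\ldots,D_5$ are the delta-matroids on the ground set $\{a,b,c\}$ with feasible sets $$\mathcal{F}(D_2)=\{\emptyset,\{a\},\{b\},\{c\},\{a,b,c\}\},$$ $$\mathcal{F}(D_3)=\{\emptyset,\{a,b\},\{b,c\},\{a,c\}\},$$ $$\mathcal{F}(D_4)=\{\emptyset,\{a,b\},\{b,c\},\{a,c\},\{a,b,c\}\},$$ $$\mathcal{F}(D_5)=\{\emptyset,\{a\},\{a,b\},\{b,c\},\{a,c\}\}.$$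
   Context: A delta-matroid $D=(E,\mathcal{F})$ consists of a finite set $E$ (the ground set) and a non-empty set $\mathcal{F}=\mathcal{F}(D)$ of subsets of $E$ (the feasible sets) satisfying the Symmetric Exchange Axiom: for all $X,Y\in\mathcal{F}$ and every $u\in X\triangle Y$ there is $v\in X\triangle Y$ (possibly $v=u$) with $X\triangle\{u,v\}\in\mathcal{F}$. Here $\triangle$ denotes symmetric difference. Two delta-matroids are isomorphic if there is a bijection between their ground sets carrying the feasible sets of one exactly onto the feasible sets of the other. The width of $D$ is $w(D)=\max_{F\in\mathcal{F}}|F|-\min_{F\in\mathcal{F}}|F|$. For $A\subseteq E$, the twist of $D$ with respect to $A$ is the delta-matroid $D*A=(E,\{A\triangle F: F\in\mathcal{F}\})$. A twist of $D$ is any $D*A$ with $A\subseteq E$ (including the empty twist $D*\emptyset=D$). Minors: an element $e$ is a coloop of $D$ if it is in every feasible set and a loop if it is in no feasible set. If $e$ is not a coloop, $D\setminus e=(E-e,\{F: F\in\mathcal{F}, F\subseteq E-e\})$. If $e$ is not a loop, $D/e=(E-e,\{F-e: F\in\mathcal{F}, e\in F\})$. If $e$ is a loop or coloop, then $D/e=D\setminus e$. The result of a sequence of deletions and contractions does not depend on the order. A minor of $D$ is any delta-matroid obtained from $D$ by a (possibly empty) sequence of deletions $D\mapsto D\setminus e$ and contractions $D\mapsto D/e$. -}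

module Defs where

open import Data.Bool.Base using (true; false; _xor_)
open import Data.Bool.Properties
  using (xor-assoc; xor-same; xor-identityˡ; xor-comm)
import Data.Bool.Properties as Bool
open import Data.Fin.Base using (Fin; zero; suc; punchIn; punchOut)
import Data.Fin.Properties as Fin
open import Data.Fin.Permutation using (Permutation; _⟨$⟩ˡ_)
open import Data.Fin.Subset
  using (Subset; Side; inside; outside; ⊥; ⁅_⁆; _∪_; _∈_; _∉_; ∣_∣)
open import Data.Fin.Subset.Properties using (_∈?_; anySubset?)
open import Data.List.Base as List using (List; []; _∷_; _++_; filter)
open import Data.List.Extrema.Nat using (max; min; xs≤max; min≤xs; argmax-sel; argmin-sel)
open import Data.List.Membership.Propositional using () renaming (_∈_ to _∈ˡ_)
open import Data.List.Membership.Propositional.Properties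
  using (∈-map⁺; ∈-map⁻; ∈-++⁺ˡ; ∈-++⁺ʳ; ∈-filter⁺; ∈-filter⁻)
import Data.List.Membership.DecPropositional as DecMembership
import Data.List.Relation.Unary.All as All
open import Data.List.Relation.Unary.Any using (here)
open import Data.Nat.Base using (ℕ; zero; suc; _≤_; _∸_)
open import Data.Product.Base using (Σ-syntax; ∃; ∃-syntax; _×_; _,_)
open import Data.Sum.Base using (inj₁; inj₂)
open import Data.Vec.Base using ([]; _∷_; zipWith; insertAt; removeAt; lookup; tabulate)
open import Data.Vec.Properties
  using (≡-dec; zipWith-assoc; zipWith-comm; zipWith-identityˡ; insertAt-lookup;
         insertAt-punchIn; insertAt-removeAt; lookup⇒[]=; []=⇒lookup)
open import Function.Base using (_∘_)
open import Function.Bundles using (_⇔_; mk⇔)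
open import Level using (0ℓ)
open import Relation.Binary.PropositionalEquality
  using (_≡_; refl; sym; trans; cong; cong₂; subst; module ≡-Reasoning)
open import Relation.Nullary.Decidable
  using (Dec; yes; no; True; toWitness; _×-dec_; _→-dec_; decidable-stable)
open import Relation.Nullary.Negation using (¬_; contradiction)
open import Relation.Unary using (Pred; Decidable)

private
  variable
    m n : ℕ

infixl 6 _△_

_△_ : Subset n → Subset n → Subset n
_△_ = zipWith _xor_

△-assoc : (X Y Z : Subset n) → (X △ Y) △ Z ≡ X △ (Y △ Z)
△-assoc = zipWith-assoc xor-assoc

△-comm : (X Y : Subset n) → X △ Y ≡ Y △ X
△-comm = zipWith-comm xor-comm

△-identityˡ : (X : Subset n) → ⊥ △ X ≡ X
△-identityˡ = zipWith-identityˡ xor-identityˡ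

△-self : (X : Subset n) → X △ X ≡ ⊥
△-self []      = refl
△-self (x ∷ X) = cong₂ _∷_ (xor-same x) (△-self X)

△-cancelˡ : (A X : Subset n) → A △ (A △ X) ≡ X
△-cancelˡ A X = begin
  A △ (A △ X) ≡⟨ △-assoc A A X ⟨
  A △ A △ X   ≡⟨ cong (_△ X) (△-self A) ⟩
  ⊥ △ X       ≡⟨ △-identityˡ X ⟩
  X           ∎
  where open ≡-Reasoning

△-cancel₂ : (A X Y : Subset n) → (A △ X) △ (A △ Y) ≡ X △ Y
△-cancel₂ A X Y = begin
  (A △ X) △ (A △ Y) ≡⟨ cong (_△ (A △ Y)) (△-comm A X) ⟩
  (X △ A) △ (A △ Y) ≡⟨ △-assoc X A (A △ Y) ⟩
  X △ (A △ (A △ Y)) ≡⟨ cong (X △_) (△-cancelˡ A Y) ⟩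
  X △ Y             ∎
  where open ≡-Reasoning

Exchange : Pred (Subset n) 0ℓ → Set
Exchange 𝓕 = ∀ {X Y} → 𝓕 X → 𝓕 Y → ∀ {u} → u ∈ X △ Y →
              ∃[ v ] v ∈ X △ Y × 𝓕 (X △ (⁅ u ⁆ ∪ ⁅ v ⁆))

-- Ground sets are taken to be Fin n.  A set of subsets of a finite set is
-- given by a decidable predicate.
record DeltaMatroid (n : ℕ) : Set₁ where
  field
    Feasible : Pred (Subset n) 0ℓ
    feasible? : Decidable Feasible
    nonempty : ∃ Feasible
    exchange : Exchange Feasible

open DeltaMatroid public

subsets : ∀ n → List (Subset n)
subsets zero    = [] ∷ []
subsets (suc n) = List.map (outside ∷_) (subsets n) ++ List.map (inside ∷_) (subsets n)

∈-subsets : (X : Subset n) → X ∈ˡ subsets n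
∈-subsets []          = here refl
∈-subsets (false ∷ X) = ∈-++⁺ˡ (∈-map⁺ _ (∈-subsets X))
∈-subsets (true ∷ X)  = ∈-++⁺ʳ _ (∈-map⁺ _ (∈-subsets X))

feasibleSizes : DeltaMatroid n → List ℕ
feasibleSizes D = List.map ∣_∣ (filter (feasible? D) (subsets _))

-- The first argument of max and min is a value for the empty list; using the
-- size of a feasible set here leaves the extrema unchanged.
maxSize minSize width : DeltaMatroid n → ℕ
maxSize D = let F , _ = nonempty D in max ∣ F ∣ (feasibleSizes D)
minSize D = let F , _ = nonempty D in min ∣ F ∣ (feasibleSizes D)
width D = maxSize D ∸ minSize D

∈-feasibleSizes : (D : DeltaMatroid n) → ∀ {X} → Feasible D X → ∣ X ∣ ∈ˡ feasibleSizes D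
∈-feasibleSizes D {X} X∈ = ∈-map⁺ ∣_∣ (∈-filter⁺ (feasible? D) (∈-subsets X) X∈)

feasibleSizes-∈ : (D : DeltaMatroid n) → ∀ {s} → s ∈ˡ feasibleSizes D →
                  ∃[ X ] Feasible D X × s ≡ ∣ X ∣
feasibleSizes-∈ D s∈ with ∈-map⁻ ∣_∣ s∈
... | X , X∈fs , eq with ∈-filter⁻ (feasible? D) {xs = subsets _} X∈fs
... | _ , X∈ = X , X∈ , eq

size≤maxSize : (D : DeltaMatroid n) → ∀ {X} → Feasible D X → ∣ X ∣ ≤ maxSize D
size≤maxSize D = All.lookup (xs≤max _ (feasibleSizes D)) ∘ ∈-feasibleSizes D

minSize≤size : (D : DeltaMatroid n) → ∀ {X} → Feasible D X → minSize D ≤ ∣ X ∣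
minSize≤size D = All.lookup (min≤xs _ (feasibleSizes D)) ∘ ∈-feasibleSizes D

maxSize-attained : (D : DeltaMatroid n) → ∃[ X ] Feasible D X × maxSize D ≡ ∣ X ∣
maxSize-attained D with nonempty D
... | F , F∈ with argmax-sel (λ s → s) ∣ F ∣ (feasibleSizes D)
... | inj₁ eq = F , F∈ , eq
... | inj₂ s∈ = feasibleSizes-∈ D s∈

minSize-attained : (D : DeltaMatroid n) → ∃[ X ] Feasible D X × minSize D ≡ ∣ X ∣
minSize-attained D with nonempty D
... | F , F∈ with argmin-sel (λ s → s) ∣ F ∣ (feasibleSizes D)
... | inj₁ eq = F , F∈ , eq
... | inj₂ s∈ = feasibleSizes-∈ D s∈

infixl 7 _*_

-- Since A △_ is an involution, X is of the form A △ F with F feasible exactly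
-- when A △ X is feasible; see twist-feasible.
_*_ : DeltaMatroid n → Subset n → DeltaMatroid n
D * A = record
  { Feasible  = λ X → Feasible D (A △ X)
  ; feasible? = λ X → feasible? D (A △ X)
  ; nonempty  = let F , F∈ = nonempty D in
                A △ F , subst (Feasible D) (sym (△-cancelˡ A F)) F∈
  ; exchange  = ex
  }
  where
  ex : Exchange (λ X → Feasible D (A △ X))
  ex {X} {Y} X∈ Y∈ {u} u∈ with exchange D X∈ Y∈ (subst (u ∈_) (sym (△-cancel₂ A X Y)) u∈)
  ... | v , v∈ , Z∈ = v , subst (v ∈_) (△-cancel₂ A X Y) v∈
                        , subst (Feasible D) (△-assoc A X (⁅ u ⁆ ∪ ⁅ v ⁆)) Z∈

twist-feasible : (D : DeltaMatroid n) (A X : Subset n) →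
                 Feasible (D * A) X ⇔ (∃[ F ] Feasible D F × X ≡ A △ F)
twist-feasible D A X = mk⇔
  (λ X∈ → A △ X , X∈ , sym (△-cancelˡ A X))
  (λ { (F , F∈ , refl) → subst (Feasible D) (sym (△-cancelˡ A F)) F∈ })

Coloop Loop : DeltaMatroid n → Fin n → Set
Coloop D e = ∀ {F} → Feasible D F → e ∈ F
Loop   D e = ∀ {F} → Feasible D F → e ∉ F

insertAt-△ : (X Y : Subset n) (e : Fin (suc n)) (s t : Side) →
             insertAt X e s △ insertAt Y e t ≡ insertAt (X △ Y) e (s xor t)
insertAt-△ X       Y       zero    s t = refl
insertAt-△ (x ∷ X) (y ∷ Y) (suc e) s t = cong (_ ∷_) (insertAt-△ X Y e s t)

insertAt-∪ : (X Y : Subset n) (e : Fin (suc n)) →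
             insertAt X e outside ∪ insertAt Y e outside ≡ insertAt (X ∪ Y) e outside
insertAt-∪ X       Y       zero    = refl
insertAt-∪ (x ∷ X) (y ∷ Y) (suc e) = cong (_ ∷_) (insertAt-∪ X Y e)

insertAt-⊥ : (e : Fin (suc n)) → insertAt ⊥ e outside ≡ ⊥
insertAt-⊥ zero            = refl
insertAt-⊥ {suc n} (suc e) = cong (outside ∷_) (insertAt-⊥ e)

insertAt-⁅⁆ : (e : Fin (suc n)) (u : Fin n) → insertAt ⁅ u ⁆ e outside ≡ ⁅ punchIn e u ⁆
insertAt-⁅⁆ zero    u       = refl
insertAt-⁅⁆ (suc e) zero    = cong (inside ∷_) (insertAt-⊥ e)
insertAt-⁅⁆ (suc e) (suc u) = cong (outside ∷_) (insertAt-⁅⁆ e u)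

∈-insertAt⁺ : (X : Subset n) (e : Fin (suc n)) (s : Side) {u : Fin n} →
              u ∈ X → punchIn e u ∈ insertAt X e s
∈-insertAt⁺ X e s {u} u∈ =
  lookup⇒[]= _ _ (trans (insertAt-punchIn X e s u) ([]=⇒lookup u∈))

∈-insertAt⁻ : (X : Subset n) (e : Fin (suc n)) {v : Fin (suc n)} →
              v ∈ insertAt X e outside → ∃[ w ] v ≡ punchIn e w × w ∈ X
∈-insertAt⁻ X e {v} v∈ with e Fin.≟ v
... | yes refl with trans (sym ([]=⇒lookup v∈)) (insertAt-lookup X e outside)
...   | ()
∈-insertAt⁻ X e {v} v∈ | no e≢v =
  w , sym eq , lookup⇒[]= w X (trans (sym (insertAt-punchIn X e outside w))
                                (trans (cong (lookup (insertAt X e outside)) eq) ([]=⇒lookup v∈)))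
  where
  w = punchOut e≢v
  eq = Fin.punchIn-punchOut e≢v

insertAt-removeAt-∈ : (F : Subset (suc n)) (e : Fin (suc n)) → e ∈ F →
                      insertAt (removeAt F e) e inside ≡ F
insertAt-removeAt-∈ F e e∈ =
  trans (cong (insertAt (removeAt F e) e) (sym ([]=⇒lookup e∈))) (insertAt-removeAt F e)

insertAt-removeAt-∉ : (F : Subset (suc n)) (e : Fin (suc n)) → e ∉ F →
                      insertAt (removeAt F e) e outside ≡ F
insertAt-removeAt-∉ F e e∉ with lookup F e in eq | insertAt-removeAt F e
... | true  | _ = contradiction (lookup⇒[]= e F eq) e∉
... | false | p = p

∈-insertAt-inside : (X : Subset n) (e : Fin (suc n)) → e ∈ insertAt X e inside
∈-insertAt-inside X e = lookup⇒[]= _ _ (insertAt-lookup X e inside)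

∉-insertAt-outside : (X : Subset n) (e : Fin (suc n)) → e ∉ insertAt X e outside
∉-insertAt-outside X e e∈ with trans (sym ([]=⇒lookup e∈)) (insertAt-lookup X e outside)
... | ()

-- The ground set E − e is relabelled as Fin n along punchIn e.  Under this
-- relabelling X ⊆ E − e is the subset insertAt X e outside of E, and X ∪ {e}
-- is insertAt X e inside.
Meets : DeltaMatroid (suc n) → Fin (suc n) → Side → Set
Meets D e s = ∃[ X ] Feasible D (insertAt X e s)

-- slice D e outside has the feasible sets {F : F ∈ 𝓕, F ⊆ E − e}, and
-- slice D e inside has {F − e : F ∈ 𝓕, e ∈ F}.
slice : (D : DeltaMatroid (suc n)) (e : Fin (suc n)) (s : Side) →
        Meets D e s → DeltaMatroid n
slice D e s ne = record
  { Feasible  = λ X → Feasible D (insertAt X e s)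
  ; feasible? = λ X → feasible? D (insertAt X e s)
  ; nonempty  = ne
  ; exchange  = ex
  }
  where
  diff : ∀ X Y → insertAt X e s △ insertAt Y e s ≡ insertAt (X △ Y) e outside
  diff X Y = trans (insertAt-△ X Y e s s) (cong (insertAt (X △ Y) e) (xor-same s))

  step : ∀ X u w → insertAt X e s △ (⁅ punchIn e u ⁆ ∪ ⁅ punchIn e w ⁆)
                 ≡ insertAt (X △ (⁅ u ⁆ ∪ ⁅ w ⁆)) e s
  step X u w = begin
    insertAt X e s △ (⁅ punchIn e u ⁆ ∪ ⁅ punchIn e w ⁆)
      ≡⟨ cong₂ (λ P Q → insertAt X e s △ (P ∪ Q)) (insertAt-⁅⁆ e u) (insertAt-⁅⁆ e w) ⟨
    insertAt X e s △ (insertAt ⁅ u ⁆ e outside ∪ insertAt ⁅ w ⁆ e outside)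
      ≡⟨ cong (insertAt X e s △_) (insertAt-∪ ⁅ u ⁆ ⁅ w ⁆ e) ⟩
    insertAt X e s △ insertAt (⁅ u ⁆ ∪ ⁅ w ⁆) e outside
      ≡⟨ insertAt-△ X _ e s outside ⟩
    insertAt (X △ (⁅ u ⁆ ∪ ⁅ w ⁆)) e (s xor outside)
      ≡⟨ cong (insertAt _ e) (Bool.xor-identityʳ s) ⟩
    insertAt (X △ (⁅ u ⁆ ∪ ⁅ w ⁆)) e s ∎
    where open ≡-Reasoning

  ex : Exchange (λ X → Feasible D (insertAt X e s))
  ex {X} {Y} X∈ Y∈ {u} u∈
    with exchange D X∈ Y∈ (subst (punchIn e u ∈_) (sym (diff X Y)) (∈-insertAt⁺ (X △ Y) e outside u∈))
  ... | v , v∈ , Z∈ with ∈-insertAt⁻ (X △ Y) e (subst (v ∈_) (diff X Y) v∈)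
  ... | w , refl , w∈ = w , w∈ , subst (Feasible D) (step X u w) Z∈

meets? : (D : DeltaMatroid (suc n)) (e : Fin (suc n)) (s : Side) → Dec (Meets D e s)
meets? D e s = anySubset? λ X → feasible? D (insertAt X e s)

∈⇒meets : (D : DeltaMatroid (suc n)) (e : Fin (suc n)) →
          ∀ {F} → Feasible D F → e ∈ F → Meets D e inside
∈⇒meets D e {F} F∈ e∈ =
  removeAt F e , subst (Feasible D) (sym (insertAt-removeAt-∈ F e e∈)) F∈

∉⇒meets : (D : DeltaMatroid (suc n)) (e : Fin (suc n)) →
          ∀ {F} → Feasible D F → e ∉ F → Meets D e outside
∉⇒meets D e {F} F∈ e∉ =
  removeAt F e , subst (Feasible D) (sym (insertAt-removeAt-∉ F e e∉)) F∈

¬meets⇒coloop : (D : DeltaMatroid (suc n)) (e : Fin (suc n)) → ¬ Meets D e outside → Coloop D e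
¬meets⇒coloop D e none {F} F∈ = decidable-stable (e ∈? F) λ e∉ → none (∉⇒meets D e F∈ e∉)

¬meets⇒loop : (D : DeltaMatroid (suc n)) (e : Fin (suc n)) → ¬ Meets D e inside → Loop D e
¬meets⇒loop D e none F∈ e∈ = none (∈⇒meets D e F∈ e∈)

coloop? : (D : DeltaMatroid (suc n)) (e : Fin (suc n)) → Dec (Coloop D e)
coloop? D e with meets? D e outside
... | yes (X , X∈) = no λ c → ∉-insertAt-outside X e (c X∈)
... | no  none     = yes (¬meets⇒coloop D e none)

loop? : (D : DeltaMatroid (suc n)) (e : Fin (suc n)) → Dec (Loop D e)
loop? D e with meets? D e inside
... | yes (X , X∈) = no λ l → l X∈ (∈-insertAt-inside X e)
... | no  none     = yes (¬meets⇒loop D e none)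

coloop⇒inside : (D : DeltaMatroid (suc n)) (e : Fin (suc n)) → Coloop D e → Meets D e inside
coloop⇒inside D e c = let _ , F∈ = nonempty D in ∈⇒meets D e F∈ (c F∈)

loop⇒outside : (D : DeltaMatroid (suc n)) (e : Fin (suc n)) → Loop D e → Meets D e outside
loop⇒outside D e l = let _ , F∈ = nonempty D in ∉⇒meets D e F∈ (l F∈)

¬coloop⇒outside : (D : DeltaMatroid (suc n)) (e : Fin (suc n)) → ¬ Coloop D e → Meets D e outside
¬coloop⇒outside D e ¬c = decidable-stable (meets? D e outside) λ none →
  ¬c (¬meets⇒coloop D e none)

¬loop⇒inside : (D : DeltaMatroid (suc n)) (e : Fin (suc n)) → ¬ Loop D e → Meets D e inside
¬loop⇒inside D e ¬l = decidable-stable (meets? D e inside) λ none →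
  ¬l (¬meets⇒loop D e none)

infixl 7 _∖_ _/_

-- A coloop is not a loop, so for a coloop e the convention D ∖ e = D / e
-- gives {F − e : F ∈ 𝓕, e ∈ F}; dually for contracting a loop.
_∖_ : DeltaMatroid (suc n) → Fin (suc n) → DeltaMatroid n
D ∖ e with coloop? D e
... | no  ¬c = slice D e outside (¬coloop⇒outside D e ¬c)
... | yes c  = slice D e inside (coloop⇒inside D e c)

_/_ : DeltaMatroid (suc n) → Fin (suc n) → DeltaMatroid n
D / e with loop? D e
... | no  ¬l = slice D e inside (¬loop⇒inside D e ¬l)
... | yes l  = slice D e outside (loop⇒outside D e l)

infix 4 _≼_ _≅_

data _≼_ {m} (M : DeltaMatroid m) : ∀ {n} → DeltaMatroid n → Set₁ where
  done     : M ≼ M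
  delete   : {D : DeltaMatroid (suc n)} (e : Fin (suc n)) → M ≼ D ∖ e → M ≼ D
  contract : {D : DeltaMatroid (suc n)} (e : Fin (suc n)) → M ≼ D / e → M ≼ D

-- j lies in the image of X exactly when its preimage under π lies in X.
image : Permutation m n → Subset m → Subset n
image π X = tabulate λ j → lookup X (π ⟨$⟩ˡ j)

_≅_ : DeltaMatroid m → DeltaMatroid n → Set
_≅_ {m} {n} D D′ =
  Σ[ π ∈ Permutation m n ] (∀ X → Feasible D X ⇔ Feasible D′ (image π X))

module _ {n : ℕ} where
  open DecMembership (≡-dec {n = n} Bool._≟_) public using () renaming (_∈?_ to _∈ˡ?_)

exchange? : (Fs : List (Subset n)) →
  Dec (All.All (λ X → All.All (λ Y → ∀ u → u ∈ X △ Y →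
         ∃[ v ] v ∈ X △ Y × X △ (⁅ u ⁆ ∪ ⁅ v ⁆) ∈ˡ Fs) Fs) Fs)
exchange? Fs = All.all? (λ X → All.all? (λ Y → Fin.all? λ u → (u ∈? X △ Y) →-dec
  Fin.any? (λ v → (v ∈? X △ Y) ×-dec (X △ (⁅ u ⁆ ∪ ⁅ v ⁆) ∈ˡ? Fs))) Fs) Fs

fromFamily : (F : Subset n) (Fs : List (Subset n)) {_ : True (exchange? (F ∷ Fs))} → DeltaMatroid n
fromFamily F Fs {ok} = record
  { Feasible  = _∈ˡ F ∷ Fs
  ; feasible? = _∈ˡ? F ∷ Fs
  ; nonempty  = F , here refl
  ; exchange  = λ X∈ Y∈ {u} → All.lookup (All.lookup (toWitness ok) X∈) Y∈ u
  }

private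
  a : Fin (suc n)
  a = zero

  b : Fin (suc (suc n))
  b = suc zero

  c : Fin (suc (suc (suc n)))
  c = suc (suc zero)

D₁ : DeltaMatroid 2
D₁ = fromFamily ⊥ (⁅ a ⁆ ∷ ⁅ b ⁆ ∷ ⁅ a ⁆ ∪ ⁅ b ⁆ ∷ [])

D₂ D₃ D₄ D₅ : DeltaMatroid 3
D₂ = fromFamily ⊥ (⁅ a ⁆ ∷ ⁅ b ⁆ ∷ ⁅ c ⁆ ∷ ⁅ a ⁆ ∪ ⁅ b ⁆ ∪ ⁅ c ⁆ ∷ [])
D₃ = fromFamily ⊥ (⁅ a ⁆ ∪ ⁅ b ⁆ ∷ ⁅ b ⁆ ∪ ⁅ c ⁆ ∷ ⁅ a ⁆ ∪ ⁅ c ⁆ ∷ [])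
D₄ = fromFamily ⊥ (⁅ a ⁆ ∪ ⁅ b ⁆ ∷ ⁅ b ⁆ ∪ ⁅ c ⁆ ∷ ⁅ a ⁆ ∪ ⁅ c ⁆ ∷ ⁅ a ⁆ ∪ ⁅ b ⁆ ∪ ⁅ c ⁆ ∷ [])
D₅ = fromFamily ⊥ (⁅ a ⁆ ∷ ⁅ a ⁆ ∪ ⁅ b ⁆ ∷ ⁅ b ⁆ ∪ ⁅ c ⁆ ∷ ⁅ a ⁆ ∪ ⁅ c ⁆ ∷ [])

data 𝓓[5] : ∀ {n} → DeltaMatroid n → Set₁ where
  twist₁ : ∀ A → 𝓓[5] (D₁ * A)
  twist₂ : ∀ A → 𝓓[5] (D₂ * A)
  twist₃ : ∀ A → 𝓓[5] (D₃ * A)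
  twist₄ : ∀ A → 𝓓[5] (D₄ * A)
  twist₅ : ∀ A → 𝓓[5] (D₅ * A)

{-# OPTIONS --safe #-}

{-
Delta-matroids with a twist of width at most one are closed under minors,
isomorphism and twisting, and D₁, …, D₅ are not among them.

Conversely, twist so that ∅ is feasible, and let G be the graph on E in which
uv is an edge if {u, v} is feasible and u is a loop if {u} is.  A subset A such
that every edge has exactly one end in A and no loop lies in A makes all
A △ F have size |A| or |A| + 1: a smallest feasible F violating this would, by
exchange towards ∅, lie on one side of A and consist of at most three elements,
and the only case that survives is a copy of D₂.  Such an A exists unless G has
a closed walk of odd length or a walk of odd length between two loops.  Take
such a walk as short as possible over all feasible sets as base.  Chords and
further loops would shorten it, so feasibility of the unions of two of its
edges, or of an edge and a loop, is forced by exchange, and moving the base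
along an edge (or a loop) of the walk gives a shorter walk.  What remains is
an edge between two loops, which is D₁, or a triangle, which gives D₃, D₄, D₅
or D₁.
-}

module Submission where

open import Defs
open import Data.Bool.Base using (Bool; true; false; not; _xor_)
import Data.Bool.Properties as Bool
open import Data.Bool.Properties
  using (not-involutive; not-injective; xor-same; xor-comm; xor-assoc; xor-identityʳ)
open import Data.Fin.Base using (Fin; zero; suc; punchIn; punchOut)
open import Data.Fin.Patterns using (0F; 1F; 2F; 3F)
open import Data.Fin.Permutation as Perm using (Permutation; permutation; _⟨$⟩ˡ_; inverseʳ)
import Data.Fin.Properties as Fin
open import Data.Fin.Subset using (Subset; ⊥; ⁅_⁆; _∪_; _∈_; ∣_∣; inside; outside)
open import Data.Fin.Subset.Properties
  using (∪-identityˡ; ∪-identityʳ; ∪-idem; anySubset?; nonempty?; Empty-unique)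
open import Data.Nat.Base using (ℕ; zero; suc; pred; _+_; _<_; _≤_; z≤n; s≤s; s≤s⁻¹)
open import Data.Nat.Properties
open import Algebra.Properties.CommutativeMonoid.Sum +-0-commutativeMonoid
  using (sum; sum-permute; sum-cong-≗)
open import Data.Product.Base using (Σ-syntax; ∃-syntax; _×_; _,_; proj₁; proj₂)
open import Data.Sum.Base using (_⊎_; inj₁; inj₂)
open import Data.Vec.Base
  using (Vec; []; _∷_; here; there; lookup; tabulate; insertAt; removeAt; updateAt)
open import Data.Vec.Properties
  using (lookup⇒[]=; []=⇒lookup; lookup-zipWith; lookup-replicate; lookup∘tabulate;
         tabulate∘lookup; tabulate-cong; lookup∘updateAt; lookup∘updateAt′; updateAt-commutes;
         updateAt-updateAt-local; updateAt-id; insertAt-lookup; insertAt-punchIn;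
         insertAt-removeAt)
open import Data.Vec.Relation.Unary.All using ([]; _∷_)
open import Data.Vec.Relation.Unary.All.Properties using (lookup⁺)
open import Data.Vec.Relation.Unary.AllPairs using ([]; _∷_)
open import Data.Vec.Relation.Unary.Unique.Propositional using (Unique)
open import Data.Vec.Relation.Unary.Unique.Propositional.Properties using (lookup-injective)
open import Function.Base using (_∘_)
open import Function.Bundles using (_⇔_; mk⇔; Equivalence)
open import Relation.Binary.PropositionalEquality
  using (_≡_; _≢_; refl; sym; trans; cong; cong₂; subst; ≢-sym; module ≡-Reasoning)
open import Relation.Nullary.Decidable
  using (Dec; yes; no; True; False; toWitness; toWitnessFalse; from-no; decidable-stable;
         ¬¬-excluded-middle)
open import Relation.Nullary.Negation using (¬_; contradiction)

private
  variable
    k m n : ℕ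

-- Subsets under toggling of single elements

lookup-ext : {X Y : Subset n} → (∀ e → lookup X e ≡ lookup Y e) → X ≡ Y
lookup-ext {X = X} {Y} eq =
  trans (sym (tabulate∘lookup X)) (trans (tabulate-cong eq) (tabulate∘lookup Y))

lookup-△ : (X Y : Subset n) (e : Fin n) → lookup (X △ Y) e ≡ lookup X e xor lookup Y e
lookup-△ X Y e = lookup-zipWith _xor_ e X Y

-- Sets near a base are written as nested toggles, which commute and cancel, instead of the unions
-- of singletons in `Exchange`.
toggle : Fin n → Subset n → Subset n
toggle u X = updateAt X u not

toggle-involutive : (u : Fin n) (X : Subset n) → toggle u (toggle u X) ≡ X
toggle-involutive u X =
  trans (updateAt-updateAt-local u X (not-involutive _)) (updateAt-id u X)

toggle-comm : (u v : Fin n) (X : Subset n) → toggle u (toggle v X) ≡ toggle v (toggle u X)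
toggle-comm u v X with u Fin.≟ v
... | yes refl = refl
... | no u≢v   = updateAt-commutes u v u≢v X

lookup-toggle : (u : Fin n) (X : Subset n) → lookup (toggle u X) u ≡ not (lookup X u)
lookup-toggle u X = lookup∘updateAt u X

lookup-toggle-≢ : {u e : Fin n} → e ≢ u → (X : Subset n) → lookup (toggle u X) e ≡ lookup X e
lookup-toggle-≢ {u = u} {e} e≢u X = lookup∘updateAt′ e u e≢u X

△-⁅⁆ : (X : Subset n) (u : Fin n) → X △ ⁅ u ⁆ ≡ toggle u X
△-⁅⁆ (x ∷ X) zero    = cong₂ _∷_ (xor-comm x true) (trans (△-comm X ⊥) (△-identityˡ X))
△-⁅⁆ (x ∷ X) (suc u) = cong₂ _∷_ (xor-identityʳ x) (△-⁅⁆ X u)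

△-⁅⁆∪⁅⁆-≡ : (X : Subset n) (u : Fin n) → X △ (⁅ u ⁆ ∪ ⁅ u ⁆) ≡ toggle u X
△-⁅⁆∪⁅⁆-≡ X u = trans (cong (X △_) (∪-idem ⁅ u ⁆)) (△-⁅⁆ X u)

△-⁅⁆∪⁅⁆-≢ : (X : Subset n) {u v : Fin n} → u ≢ v → X △ (⁅ u ⁆ ∪ ⁅ v ⁆) ≡ toggle u (toggle v X)
△-⁅⁆∪⁅⁆-≢ X       {zero}  {zero}  u≢v = contradiction refl u≢v
△-⁅⁆∪⁅⁆-≢ (x ∷ X) {zero}  {suc v} u≢v =
  cong₂ _∷_ (xor-comm x true) (trans (cong (X △_) (∪-identityˡ ⁅ v ⁆)) (△-⁅⁆ X v))
△-⁅⁆∪⁅⁆-≢ (x ∷ X) {suc u} {zero}  u≢v =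
  cong₂ _∷_ (xor-comm x true) (trans (cong (X △_) (∪-identityʳ ⁅ u ⁆)) (△-⁅⁆ X u))
△-⁅⁆∪⁅⁆-≢ (x ∷ X) {suc u} {suc v} u≢v =
  cong₂ _∷_ (xor-identityʳ x) (△-⁅⁆∪⁅⁆-≢ X (u≢v ∘ cong suc))

△-toggle : (u : Fin n) (X Y : Subset n) → X △ toggle u Y ≡ toggle u (X △ Y)
△-toggle u X Y = begin
  X △ toggle u Y    ≡⟨ cong (X △_) (△-⁅⁆ Y u) ⟨
  X △ (Y △ ⁅ u ⁆)   ≡⟨ △-assoc X Y ⁅ u ⁆ ⟨
  X △ Y △ ⁅ u ⁆     ≡⟨ △-⁅⁆ (X △ Y) u ⟩
  toggle u (X △ Y)  ∎
  where open ≡-Reasoning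

-- For distinct entries this is `B` △ the part of `xs` selected by `S`. For explicit `xs` and `S` it
-- reduces to nested toggles, so facts about toggles of `B` serve directly as facts about a small
-- delta-matroid.
flip : Vec (Fin n) k → Subset n → Subset k → Subset n
flip []       B []          = B
flip (x ∷ xs) B (true ∷ S)  = toggle x (flip xs B S)
flip (x ∷ xs) B (false ∷ S) = flip xs B S

flip-⊥ : (xs : Vec (Fin n) k) (B : Subset n) → flip xs B ⊥ ≡ B
flip-⊥ []       B = refl
flip-⊥ (x ∷ xs) B = flip-⊥ xs B

flip-toggle : (xs : Vec (Fin n) k) (B : Subset n) (i : Fin k) (S : Subset k) →
              flip xs B (toggle i S) ≡ toggle (lookup xs i) (flip xs B S)
flip-toggle (x ∷ xs) B zero    (true ∷ S)  = sym (toggle-involutive x _)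
flip-toggle (x ∷ xs) B zero    (false ∷ S) = refl
flip-toggle (x ∷ xs) B (suc i) (true ∷ S)  =
  trans (cong (toggle x) (flip-toggle xs B i S)) (toggle-comm x (lookup xs i) _)
flip-toggle (x ∷ xs) B (suc i) (false ∷ S) = flip-toggle xs B i S

△-flip : (xs : Vec (Fin n) k) (A B : Subset n) (S : Subset k) →
         A △ flip xs B S ≡ flip xs (A △ B) S
△-flip []       A B []          = refl
△-flip (x ∷ xs) A B (true ∷ S)  =
  trans (△-toggle x A (flip xs B S)) (cong (toggle x) (△-flip xs A B S))
△-flip (x ∷ xs) A B (false ∷ S) = △-flip xs A B S

lookup-flip-∉ : (xs : Vec (Fin n) k) (B : Subset n) (S : Subset k) {e : Fin n} →
                (∀ i → lookup xs i ≢ e) → lookup (flip xs B S) e ≡ lookup B e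
lookup-flip-∉ []       B []          e∉ = refl
lookup-flip-∉ (x ∷ xs) B (true ∷ S)  e∉ =
  trans (lookup-toggle-≢ (≢-sym (e∉ zero)) (flip xs B S)) (lookup-flip-∉ xs B S (e∉ ∘ suc))
lookup-flip-∉ (x ∷ xs) B (false ∷ S) e∉ = lookup-flip-∉ xs B S (e∉ ∘ suc)

lookup-flip : {xs : Vec (Fin n) k} → Unique xs → (B : Subset n) (S : Subset k) (i : Fin k) →
              lookup (flip xs B S) (lookup xs i) ≡ lookup S i xor lookup B (lookup xs i)
lookup-flip {xs = x ∷ xs} (x∉ ∷ uniq) B (true ∷ S) zero =
  trans (lookup-toggle x (flip xs B S)) (cong not (lookup-flip-∉ xs B S λ i eq → lookup⁺ x∉ i (sym eq)))
lookup-flip {xs = x ∷ xs} (x∉ ∷ uniq) B (false ∷ S) zero =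
  lookup-flip-∉ xs B S λ i eq → lookup⁺ x∉ i (sym eq)
lookup-flip {xs = x ∷ xs} (x∉ ∷ uniq) B (true ∷ S) (suc i) =
  trans (lookup-toggle-≢ (≢-sym (lookup⁺ x∉ i)) (flip xs B S)) (lookup-flip uniq B S i)
lookup-flip {xs = x ∷ xs} (x∉ ∷ uniq) B (false ∷ S) (suc i) = lookup-flip uniq B S i

lookup-flip-△ : {xs : Vec (Fin n) k} → Unique xs → (B : Subset n) (X Y : Subset k) (i : Fin k) →
                lookup (flip xs B X △ flip xs B Y) (lookup xs i) ≡ lookup (X △ Y) i
lookup-flip-△ {xs = xs} uniq B X Y i = begin
  lookup (flip xs B X △ flip xs B Y) x            ≡⟨ lookup-△ (flip xs B X) _ x ⟩
  lookup (flip xs B X) x xor lookup (flip xs B Y) x ≡⟨ cong₂ _xor_ (lookup-flip uniq B X i) (lookup-flip uniq B Y i) ⟩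
  (lookup X i xor b) xor (lookup Y i xor b)       ≡⟨ cong ((lookup X i xor b) xor_) (xor-comm (lookup Y i) b) ⟩
  (lookup X i xor b) xor (b xor lookup Y i)       ≡⟨ xor-assoc (lookup X i) b _ ⟩
  lookup X i xor (b xor (b xor lookup Y i))       ≡⟨ cong (lookup X i xor_) (xor-assoc b b _) ⟨
  lookup X i xor ((b xor b) xor lookup Y i)       ≡⟨ cong (λ z → lookup X i xor (z xor lookup Y i)) (xor-same b) ⟩
  lookup X i xor lookup Y i                       ≡⟨ lookup-△ X Y i ⟨
  lookup (X △ Y) i                                ∎
  where
  open ≡-Reasoning
  x = lookup xs i
  b = lookup B x

-- Flips of the same base agree off `xs`, so an exchange between them never leaves the entries of
-- `xs`.
∈-flip-△⁻ : {xs : Vec (Fin n) k} → Unique xs → (B : Subset n) (X Y : Subset k) {e : Fin n} →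
            e ∈ flip xs B X △ flip xs B Y → ∃[ i ] lookup xs i ≡ e × i ∈ X △ Y
∈-flip-△⁻ {xs = xs} uniq B X Y {e} e∈ with Fin.any? (λ i → lookup xs i Fin.≟ e)
... | yes (i , refl) =
  i , refl , lookup⇒[]= i _ (trans (sym (lookup-flip-△ uniq B X Y i)) ([]=⇒lookup e∈))
... | no e∉ = contradiction (trans (sym ([]=⇒lookup e∈)) e≡) λ ()
  where
  open ≡-Reasoning
  off : ∀ S → lookup (flip xs B S) e ≡ lookup B e
  off S = lookup-flip-∉ xs B S λ i eq → e∉ (i , eq)
  e≡ : lookup (flip xs B X △ flip xs B Y) e ≡ false
  e≡ = begin
    lookup (flip xs B X △ flip xs B Y) e              ≡⟨ lookup-△ (flip xs B X) _ e ⟩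
    lookup (flip xs B X) e xor lookup (flip xs B Y) e ≡⟨ cong₂ _xor_ (off X) (off Y) ⟩
    lookup B e xor lookup B e                         ≡⟨ xor-same (lookup B e) ⟩
    false                                             ∎

flip-△-pair : {xs : Vec (Fin n) k} → Unique xs → (B : Subset n) (X : Subset k) (u v : Fin k) →
              flip xs B X △ (⁅ lookup xs u ⁆ ∪ ⁅ lookup xs v ⁆) ≡ flip xs B (X △ (⁅ u ⁆ ∪ ⁅ v ⁆))
flip-△-pair {xs = xs} uniq B X u v with u Fin.≟ v
... | yes refl = begin
  flip xs B X △ (⁅ lookup xs u ⁆ ∪ ⁅ lookup xs u ⁆) ≡⟨ △-⁅⁆∪⁅⁆-≡ (flip xs B X) _ ⟩
  toggle (lookup xs u) (flip xs B X)                ≡⟨ flip-toggle xs B u X ⟨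
  flip xs B (toggle u X)                            ≡⟨ cong (flip xs B) (△-⁅⁆∪⁅⁆-≡ X u) ⟨
  flip xs B (X △ (⁅ u ⁆ ∪ ⁅ u ⁆))                   ∎
  where open ≡-Reasoning
... | no u≢v = begin
  flip xs B X △ (⁅ lookup xs u ⁆ ∪ ⁅ lookup xs v ⁆)       ≡⟨ △-⁅⁆∪⁅⁆-≢ (flip xs B X) (u≢v ∘ lookup-injective uniq u v) ⟩
  toggle (lookup xs u) (toggle (lookup xs v) (flip xs B X)) ≡⟨ cong (toggle _) (flip-toggle xs B v X) ⟨
  toggle (lookup xs u) (flip xs B (toggle v X))           ≡⟨ flip-toggle xs B u (toggle v X) ⟨
  flip xs B (toggle u (toggle v X))                       ≡⟨ cong (flip xs B) (△-⁅⁆∪⁅⁆-≢ X u≢v) ⟨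
  flip xs B (X △ (⁅ u ⁆ ∪ ⁅ v ⁆))                         ∎
  where open ≡-Reasoning

-- The minor of D in which the elements outside xs are fixed as they are in B,
-- twisted so that B becomes the empty set.
local : (D : DeltaMatroid n) {B : Subset n} → Feasible D B →
        {xs : Vec (Fin n) k} → Unique xs → DeltaMatroid k
local D {B} B∈ {xs} uniq = record
  { Feasible  = λ S → Feasible D (flip xs B S)
  ; feasible? = λ S → feasible? D (flip xs B S)
  ; nonempty  = ⊥ , subst (Feasible D) (sym (flip-⊥ xs B)) B∈
  ; exchange  = ex
  }
  where
  ex : Exchange (λ S → Feasible D (flip xs B S))
  ex {X} {Y} X∈ Y∈ {u} u∈
    with exchange D X∈ Y∈ {lookup xs u}
           (lookup⇒[]= _ _ (trans (lookup-flip-△ uniq B X Y u) ([]=⇒lookup u∈)))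
  ... | e , e∈ , Z∈ with ∈-flip-△⁻ uniq B X Y e∈
  ... | w , refl , w∈ = w , w∈ , subst (Feasible D) (flip-△-pair uniq B X u w) Z∈

-- Patterns around a base set realised as minors

flip-lookup : {xs : Vec (Fin n) k} → Unique xs → (B X : Subset n) →
              (∀ e → (∀ i → lookup xs i ≢ e) → lookup X e ≡ lookup B e) →
              flip xs B (tabulate (lookup B ∘ lookup xs) △ tabulate (lookup X ∘ lookup xs)) ≡ X
flip-lookup {xs = xs} uniq B X agree = lookup-ext same
  where
  open ≡-Reasoning
  PB = tabulate (lookup B ∘ lookup xs)
  PX = tabulate (lookup X ∘ lookup xs)
  same : ∀ e → lookup (flip xs B (PB △ PX)) e ≡ lookup X e
  same e with Fin.any? (λ i → lookup xs i Fin.≟ e)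
  ... | no e∉ = trans (lookup-flip-∉ xs B (PB △ PX) e∉′) (sym (agree e e∉′))
    where e∉′ = λ i eq → e∉ (i , eq)
  ... | yes (i , refl) = begin
    lookup (flip xs B (PB △ PX)) e   ≡⟨ lookup-flip uniq B (PB △ PX) i ⟩
    lookup (PB △ PX) i xor b         ≡⟨ cong (_xor b) (lookup-△ PB PX i) ⟩
    (lookup PB i xor lookup PX i) xor b ≡⟨ cong₂ (λ p q → (p xor q) xor b) (lookup∘tabulate _ i) (lookup∘tabulate _ i) ⟩
    (b xor x) xor b                  ≡⟨ xor-comm (b xor x) b ⟩
    b xor (b xor x)                  ≡⟨ xor-assoc b b x ⟨
    (b xor b) xor x                  ≡⟨ cong (_xor x) (xor-same b) ⟩
    x                                ∎
    where
    b = lookup B e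
    x = lookup X e

-- `D ∖ e` and `D / e` unfold only once the coloop or loop question is decided. The constructor is
-- abstracted along with the decision, and the witness `ne` is the one which that decision builds.
≼-slice : (D : DeltaMatroid (suc n)) (e : Fin (suc n)) (s : Bool) → Meets D e s →
          ∃[ ne ] (∀ {m} {M : DeltaMatroid m} → M ≼ slice D e s ne → M ≼ D)
≼-slice D e false (X , X∈) with coloop? D e | (λ {m} {M : DeltaMatroid m} → delete {M = M} {D = D} e)
... | no ¬c | del = ¬coloop⇒outside D e ¬c , del
... | yes c | _   = contradiction (c X∈) (∉-insertAt-outside X e)
≼-slice D e true (X , X∈) with loop? D e | (λ {m} {M : DeltaMatroid m} → contract {M = M} {D = D} e)
... | no ¬l | con = ¬loop⇒inside D e ¬l , con
... | yes l | _   = contradiction (∈-insertAt-inside X e) (l X∈)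

-- Elements outside the image of `f` are removed one by one, contracted if they lie in `B` and
-- deleted otherwise. As `B` stays feasible, the conventions for loops and coloops are never met.
-- When no such element is left, `f` is a bijection.
≼-local : (D : DeltaMatroid n) {N : DeltaMatroid k} (f : Fin k → Fin n) →
          (∀ {i j} → f i ≡ f j → i ≡ j) → (B : Subset n) → Feasible D B →
          (∀ X → (∀ e → (∀ i → f i ≢ e) → lookup X e ≡ lookup B e) →
             Feasible D X ⇔ Feasible N (tabulate (lookup X ∘ f))) →
          ∃[ m ] Σ[ M ∈ DeltaMatroid m ] M ≼ D × M ≅ N
≼-local {n} {k} D {N} f f-inj B B∈ same with Fin.all? (λ e → Fin.any? (λ i → f i Fin.≟ e))
-- `image π X` is by definition the trace of `X` along `f`, so `same` is the isomorphism.
... | yes onto = n , D , done , π , (λ X → same X (λ e e∉ → contradiction (proj₂ (onto e)) (e∉ _)))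
  where
  g : Fin n → Fin k
  g e = proj₁ (onto e)
  π : Permutation n k
  π = permutation g f
    (λ i → f-inj (proj₂ (onto (f i))))
    (λ e → proj₂ (onto e))
≼-local {zero} D f f-inj B B∈ same | no ¬onto = contradiction (λ ()) ¬onto
≼-local {suc n} {k} D {N} f f-inj B B∈ same | no ¬onto
  with Fin.¬∀⟶∃¬ _ _ (λ e → Fin.any? λ i → f i Fin.≟ e) ¬onto
... | e , e∉′ with ≼-slice D e (lookup B e) (removeAt B e , subst (Feasible D) (sym (insertAt-removeAt B e)) B∈)
... | ne , up with ≼-local (slice D e (lookup B e) ne) {N} f′ f′-inj (removeAt B e)
                     (subst (Feasible D) (sym (insertAt-removeAt B e)) B∈) same′
  where
  e∉ : ∀ i → e ≢ f i
  e∉ i eq = e∉′ (i , sym eq)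
  f′ : Fin k → Fin n
  f′ i = punchOut (e∉ i)
  f′-inj : ∀ {i j} → f′ i ≡ f′ j → i ≡ j
  f′-inj {i} {j} eq = f-inj (Fin.punchOut-injective (e∉ i) (e∉ j) eq)
  same′ : ∀ X → (∀ d → (∀ i → f′ i ≢ d) → lookup X d ≡ lookup (removeAt B e) d) →
          Feasible D (insertAt X e (lookup B e)) ⇔ Feasible N (tabulate (lookup X ∘ f′))
  same′ X agree = subst (λ Z → Feasible D X⁺ ⇔ Feasible N Z) (tabulate-cong pre) (same X⁺ agree⁺)
    where
    X⁺ = insertAt X e (lookup B e)
    pre : ∀ i → lookup X⁺ (f i) ≡ lookup X (f′ i)
    pre i = trans (cong (lookup X⁺) (sym (Fin.punchIn-punchOut (e∉ i)))) (insertAt-punchIn X e _ (f′ i))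
    agree⁺ : ∀ d → (∀ i → f i ≢ d) → lookup X⁺ d ≡ lookup B d
    agree⁺ d d∉ with e Fin.≟ d
    ... | yes refl = insertAt-lookup X e _
    ... | no e≢d = begin
      lookup X⁺ d                            ≡⟨ cong (lookup X⁺) (Fin.punchIn-punchOut e≢d) ⟨
      lookup X⁺ (punchIn e d′)               ≡⟨ insertAt-punchIn X e _ d′ ⟩
      lookup X d′                            ≡⟨ agree d′ (λ i eq → d∉ i (Fin.punchOut-injective (e∉ i) e≢d eq)) ⟩
      lookup (removeAt B e) d′               ≡⟨ insertAt-punchIn (removeAt B e) e (lookup B e) d′ ⟨
      lookup (insertAt (removeAt B e) e (lookup B e)) (punchIn e d′)
                                             ≡⟨ cong₂ lookup (insertAt-removeAt B e) (Fin.punchIn-punchOut e≢d) ⟩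
      lookup B d                             ∎
      where
      open ≡-Reasoning
      d′ = punchOut e≢d
... | m , M , M≼ , M≅ = m , M , up M≼ , M≅

-- Forced feasible sets and excluded patterns on few elements

pattern O = outside
pattern I = inside

-- In this and the next lemma, exchange at 0F from a pair towards the other
-- pair (or singleton) can only reach the asserted set, or a set that is
-- infeasible or from which exchange at 0F towards ∅ is impossible.
pair∪pair : (R : DeltaMatroid 4) → Feasible R (O ∷ O ∷ O ∷ O ∷ []) →
            Feasible R (I ∷ I ∷ O ∷ O ∷ []) → Feasible R (O ∷ O ∷ I ∷ I ∷ []) →
            ¬ Feasible R (I ∷ O ∷ O ∷ O ∷ []) → ¬ Feasible R (I ∷ O ∷ I ∷ O ∷ []) →
            ¬ Feasible R (I ∷ O ∷ O ∷ I ∷ []) → Feasible R (I ∷ I ∷ I ∷ I ∷ [])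
pair∪pair R p∅ p01 p23 ¬p0 ¬p02 ¬p03 with exchange R p23 p01 {0F} here
... | 1F , _ , p = p
... | 2F , _ , p = contradiction p ¬p03
... | 3F , _ , p = contradiction p ¬p02
... | 0F , _ , p with exchange R p∅ p {0F} here
...   | 0F , _ , q = contradiction q ¬p0
...   | 1F , there () , _
...   | 2F , _ , q = contradiction q ¬p02
...   | 3F , _ , q = contradiction q ¬p03

pair∪single : (R : DeltaMatroid 3) →
              Feasible R (I ∷ I ∷ O ∷ []) → Feasible R (O ∷ O ∷ I ∷ []) →
              ¬ Feasible R (I ∷ O ∷ O ∷ []) → ¬ Feasible R (I ∷ O ∷ I ∷ []) →
              Feasible R (I ∷ I ∷ I ∷ [])
pair∪single R p01 p2 ¬p0 ¬p02 with exchange R p2 p01 {0F} here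
... | 0F , _ , p = contradiction p ¬p02
... | 1F , _ , p = p
... | 2F , _ , p = contradiction p ¬p0

-- The excluded-minor hypothesis as it is used: no table of feasibility around any base, feasible or
-- not, matches `N`. Since all twists of `N` are excluded, the choice of base is immaterial.
Free : DeltaMatroid n → Set₁
Free {n} D = ∀ {k} (N : DeltaMatroid k) → (∀ A → 𝓓[5] (N * A)) →
             {xs : Vec (Fin n) k} → Unique xs → ∀ B →
             ¬ (∀ S → Feasible D (flip xs B S) ⇔ Feasible N S)

-- One row of a comparison with an explicit `N`, whose side is settled by evaluation.
both : {P : Set} {N : DeltaMatroid k} {S : Subset k} → P → {True (feasible? N S)} → P ⇔ Feasible N S
both p {t} = mk⇔ (λ _ → toWitness t) (λ _ → p)

neither : {P : Set} {N : DeltaMatroid k} {S : Subset k} → ¬ P → {False (feasible? N S)} → P ⇔ Feasible N S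
neither ¬p {f} = mk⇔ (λ p → contradiction p ¬p) (λ q → contradiction q (toWitnessFalse f))

-- Walks of given parity in the graph of a base set

odd : ℕ → Bool
odd zero    = false
odd (suc l) = not (odd l)

odd-+ : ∀ p q → odd (p + q) ≡ odd p xor odd q
odd-+ zero    q = refl
odd-+ (suc p) q = trans (cong not (odd-+ p q)) (Bool.not-distribˡ-xor (odd p) (odd q))

odd>0 : ∀ {q} → odd q ≡ true → 0 < q
odd>0 {suc q} _ = s≤s z≤n

toggle-rotate : (a b c : Fin n) (B : Subset n) → toggle a (toggle b (toggle c B)) ≡ toggle b (toggle c (toggle a B))
toggle-rotate a b c B = trans (toggle-comm a b _) (cong (toggle b) (toggle-comm a c B))

toggle-rotate₄ : (a b c d : Fin n) (B : Subset n) → toggle a (toggle b (toggle c (toggle d B))) ≡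
                               toggle b (toggle c (toggle d (toggle a B)))
toggle-rotate₄ a b c d B = trans (toggle-comm a b _) (cong (toggle b) (toggle-rotate a c d B))

module _ (D : DeltaMatroid n) where

  private
    variable
      B : Subset n
      a b c u v w x y z : Fin n
      l p q : ℕ

  -- A loop of the graph at `B`, unlike `Loop`, which concerns the delta-matroid.
  IsLoop : Subset n → Fin n → Set
  IsLoop B u = Feasible D (toggle u B)

  Adj : Subset n → Fin n → Fin n → Set
  Adj B u v = u ≢ v × Feasible D (toggle u (toggle v B))

  Adj-sym : Adj B u v → Adj B v u
  Adj-sym {B} {u} {v} (u≢v , p) = ≢-sym u≢v , subst (Feasible D) (toggle-comm u v B) p

  unique₂ : u ≢ v → Unique (u ∷ v ∷ [])
  unique₂ u≢v = (u≢v ∷ []) ∷ [] ∷ []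

  unique₃ : u ≢ v → u ≢ w → v ≢ w → Unique (u ∷ v ∷ w ∷ [])
  unique₃ u≢v u≢w v≢w = (u≢v ∷ u≢w ∷ []) ∷ unique₂ v≢w

  unique₄ : u ≢ v → u ≢ w → u ≢ x → v ≢ w → v ≢ x → w ≢ x → Unique (u ∷ v ∷ w ∷ x ∷ [])
  unique₄ u≢v u≢w u≢x v≢w v≢x w≢x = (u≢v ∷ u≢w ∷ u≢x ∷ []) ∷ unique₃ v≢w v≢x w≢x

  infixr 5 _∷_
  data Walk (B : Subset n) : Fin n → Fin n → ℕ → Set where
    []  : Walk B x x 0
    _∷_ : Adj B x y → Walk B y z l → Walk B x z (suc l)

  snoc : Walk B x y l → Adj B y z → Walk B x z (suc l)
  snoc []      f = f ∷ []
  snoc (e ∷ W) f = e ∷ snoc W f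

  reverse : Walk B x y l → Walk B y x l
  reverse []      = []
  reverse (e ∷ W) = snoc (reverse W) (Adj-sym e)

  _++ʷ_ : Walk B x y p → Walk B y z q → Walk B x z (p + q)
  []      ++ʷ V = V
  (e ∷ W) ++ʷ V = e ∷ (W ++ʷ V)

  -- Each edge comes with the stretches of walk before and after it, because the proof that it
  -- survives a change of base uses its position.
  mapWalk : ∀ {B′} → Walk B x y l →
            (∀ {z w i j} → Walk B x z i → Adj B z w → Walk B w y j → i + suc j ≡ l → Adj B′ z w) →
            Walk B′ x y l
  mapWalk []      f = []
  mapWalk (e ∷ W) f = f [] e W refl ∷ mapWalk W (λ U e′ V eq → f (e ∷ U) e′ V (cong suc eq))

  Apart : Subset n → Fin n → Fin n → Set
  Apart B u v = u ≢ v × ¬ Feasible D (toggle u (toggle v B))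

  Apart-sym : Apart B u v → Apart B v u
  Apart-sym {B} {u} {v} (u≢v , ¬p) = ≢-sym u≢v , ¬p ∘ subst (Feasible D) (toggle-comm v u B)

  -- This is what lets the edge `wz` survive when the base moves along `uv`. Only the end `w` has to
  -- be loopless and without chords to `u` and `v`.
  edge∪edge : Feasible D B → Adj B w z → Adj B u v → ¬ IsLoop B w → Apart B w u → Apart B w v →
              z ≢ u → z ≢ v → Feasible D (toggle w (toggle z (toggle u (toggle v B))))
  edge∪edge B∈ (w≢z , pwz) (u≢v , puv) ¬pw (w≢u , ¬pwu) (w≢v , ¬pwv) z≢u z≢v =
    pair∪pair (local D B∈ (unique₄ w≢z w≢u w≢v z≢u z≢v u≢v)) B∈ pwz puv ¬pw ¬pwu ¬pwv

  edge∪loop : Feasible D B → Adj B w z → IsLoop B u → ¬ IsLoop B w → Apart B w u → z ≢ u →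
              Feasible D (toggle w (toggle z (toggle u B)))
  edge∪loop B∈ (w≢z , pwz) pu ¬pw (w≢u , ¬pwu) z≢u =
    pair∪single (local D B∈ (unique₃ w≢z w≢u z≢u)) pwz pu ¬pw ¬pwu

  Adj-comm : Adj (toggle u (toggle v B)) x y → Adj (toggle v (toggle u B)) y x
  Adj-comm {u} {v} {B} {x} {y} =
    Adj-sym ∘ subst (λ B′ → Adj B′ x y) (toggle-comm u v B)

  -- A walk between loops counts as one longer than it is: moving the base along one of the loops
  -- yields a closed walk of the same length, and the weight makes this a descent. All bases are
  -- covered because the base moves.
  NoOddClosed NoOddLooped : ℕ → Set
  NoOddClosed m = ∀ {B x l} → Feasible D B → Walk B x x l → odd l ≡ true → ¬ l < m
  NoOddLooped m = ∀ {B a b l} → Feasible D B → IsLoop B a → IsLoop B b →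
                  Walk B a b l → odd l ≡ true → ¬ suc l < m

  -- A vertex cuts an even stretch into two parts of equal parity; depending on it, one part or the
  -- other completes to an odd walk.
  odd-summand : ∀ p → p + q ≡ l → odd l ≡ false → odd p ≡ odd q
  odd-summand {q} p refl even with odd p | odd q | trans (sym (odd-+ p q)) even
  ... | false | false | _ = refl
  ... | true  | true  | _ = refl

  -- Loops, edges and triangles excluded by the five delta-matroids

  module _ (free : Free D) where

    no-looped-edge : Feasible D B → Adj B u v → IsLoop B u → ¬ IsLoop B v
    no-looped-edge {B} B∈ (u≢v , puv) pu pv = free D₁ twist₁ (unique₂ u≢v) B λ
      { (O ∷ O ∷ []) → both {N = D₁} B∈
      ; (I ∷ O ∷ []) → both {N = D₁} pu
      ; (O ∷ I ∷ []) → both {N = D₁} pv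
      ; (I ∷ I ∷ []) → both {N = D₁} puv
      }

    -- Of the eight sets only {a} and {a, b, c}, relative to `B`, are undetermined, which leaves
    -- four cases.
    no-triangle′ : Feasible D B → ¬ IsLoop B b → ¬ IsLoop B c →
                   Adj B a b → Adj B b c → ¬ Adj B a c
    no-triangle′ {B} {b} {c} {a} B∈ ¬pb ¬pc (a≢b , pab) (b≢c , pbc) (a≢c , pac)
      with feasible? D (toggle a B) | feasible? D (toggle a (toggle b (toggle c B)))
    ... | no ¬pa | no ¬pabc = free D₃ twist₃ (unique₃ a≢b a≢c b≢c) B λ
      { (O ∷ O ∷ O ∷ []) → both {N = D₃} B∈
      ; (I ∷ O ∷ O ∷ []) → neither {N = D₃} ¬pa
      ; (O ∷ I ∷ O ∷ []) → neither {N = D₃} ¬pb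
      ; (O ∷ O ∷ I ∷ []) → neither {N = D₃} ¬pc
      ; (I ∷ I ∷ O ∷ []) → both {N = D₃} pab
      ; (O ∷ I ∷ I ∷ []) → both {N = D₃} pbc
      ; (I ∷ O ∷ I ∷ []) → both {N = D₃} pac
      ; (I ∷ I ∷ I ∷ []) → neither {N = D₃} ¬pabc
      }
    ... | no ¬pa | yes pabc = free D₄ twist₄ (unique₃ a≢b a≢c b≢c) B λ
      { (O ∷ O ∷ O ∷ []) → both {N = D₄} B∈
      ; (I ∷ O ∷ O ∷ []) → neither {N = D₄} ¬pa
      ; (O ∷ I ∷ O ∷ []) → neither {N = D₄} ¬pb
      ; (O ∷ O ∷ I ∷ []) → neither {N = D₄} ¬pc
      ; (I ∷ I ∷ O ∷ []) → both {N = D₄} pab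
      ; (O ∷ I ∷ I ∷ []) → both {N = D₄} pbc
      ; (I ∷ O ∷ I ∷ []) → both {N = D₄} pac
      ; (I ∷ I ∷ I ∷ []) → both {N = D₄} pabc
      }
    ... | yes pa | no ¬pabc = free D₅ twist₅ (unique₃ a≢b a≢c b≢c) B λ
      { (O ∷ O ∷ O ∷ []) → both {N = D₅} B∈
      ; (I ∷ O ∷ O ∷ []) → both {N = D₅} pa
      ; (O ∷ I ∷ O ∷ []) → neither {N = D₅} ¬pb
      ; (O ∷ O ∷ I ∷ []) → neither {N = D₅} ¬pc
      ; (I ∷ I ∷ O ∷ []) → both {N = D₅} pab
      ; (O ∷ I ∷ I ∷ []) → both {N = D₅} pbc
      ; (I ∷ O ∷ I ∷ []) → both {N = D₅} pac
      ; (I ∷ I ∷ I ∷ []) → neither {N = D₅} ¬pabc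
      }
    -- After contracting a, all subsets of {b, c} are feasible.
    ... | yes pa | yes pabc = no-looped-edge pa
      (b≢c , subst (Feasible D) (trans (toggle-comm a b _) (cong (toggle b) (toggle-comm a c B))) pabc)
      (subst (Feasible D) (toggle-comm a b B) pab) (subst (Feasible D) (toggle-comm a c B) pac)

    -- Adjacent vertices are not both loops, so at most one vertex of the triangle is a loop, and it
    -- can be rotated into first place.
    no-triangle : Feasible D B → Adj B a b → Adj B b c → ¬ Adj B c a
    no-triangle {B} {a} {b} {c} B∈ ab bc ca with feasible? D (toggle a B) | feasible? D (toggle b B)
    ... | yes pa | _ = no-triangle′ B∈ (no-looped-edge B∈ ab pa)
      (no-looped-edge B∈ (Adj-sym ca) pa) ab bc (Adj-sym ca)
    ... | no ¬pa | yes pb = no-triangle′ B∈ (no-looped-edge B∈ bc pb) ¬pa bc ca (Adj-sym ab)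
    ... | no ¬pa | no ¬pb = no-triangle′ B∈ ¬pa ¬pb ca ab (Adj-sym bc)

    no-D₂ : Feasible D B → u ≢ v → u ≢ w → v ≢ w →
            IsLoop B u → IsLoop B v → IsLoop B w →
            ¬ Feasible D (toggle u (toggle v (toggle w B)))
    no-D₂ {B} B∈ u≢v u≢w v≢w pu pv pw puvw = free D₂ twist₂ (unique₃ u≢v u≢w v≢w) B λ
      { (O ∷ O ∷ O ∷ []) → both {N = D₂} B∈
      ; (I ∷ O ∷ O ∷ []) → both {N = D₂} pu
      ; (O ∷ I ∷ O ∷ []) → both {N = D₂} pv
      ; (O ∷ O ∷ I ∷ []) → both {N = D₂} pw
      ; (I ∷ I ∷ O ∷ []) → neither {N = D₂} (λ puv → no-looped-edge B∈ (u≢v , puv) pu pv)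
      ; (O ∷ I ∷ I ∷ []) → neither {N = D₂} (λ pvw → no-looped-edge B∈ (v≢w , pvw) pv pw)
      ; (I ∷ O ∷ I ∷ []) → neither {N = D₂} (λ puw → no-looped-edge B∈ (u≢w , puw) pu pw)
      ; (I ∷ I ∷ I ∷ []) → both {N = D₂} puvw
      }

    -- Shortening odd closed walks and odd walks between loops

    module _ {m : ℕ} (noClosed : NoOddClosed m) (noLooped : NoOddLooped m) where

      -- z is a vertex of the closed walk x → u → v → y ⇝ z ⇝ x.
      module _ (B∈ : Feasible D B) (xu : Adj B x u) (uv : Adj B u v) (vy : Adj B v y)
               (even : odd l ≡ false) (l≤m : 3 + l ≤ m)
               (P : Walk B y z p) (Q : Walk B z x q) (p+q≡l : p + q ≡ l) where

        private
          3+p≤m : 3 + p ≤ m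
          3+p≤m = ≤-trans (+-monoʳ-≤ 3 (m+n≤o⇒m≤o p (≤-reflexive p+q≡l))) l≤m

          3+q≤m : 3 + q ≤ m
          3+q≤m = ≤-trans (+-monoʳ-≤ 3 (m+n≤o⇒n≤o p (≤-reflexive p+q≡l))) l≤m

          3+p<m : 0 < q → 3 + p < m
          3+p<m 0<q = ≤-trans (+-monoʳ-≤ 3 (≤-trans (m<m+n p 0<q) (≤-reflexive p+q≡l))) l≤m

          odd-q : ∀ {s} → odd p ≡ s → odd q ≡ s
          odd-q = trans (sym (odd-summand p p+q≡l even))

        -- A return to `u` splits off the closed walk through `x` or the one through `v` and `y`,
        -- and one of the two is odd.
        ≢-cycle : z ≢ u
        ≢-cycle refl with odd p in odd-p
        ... | false = noClosed B∈ (xu ∷ Q) (cong not (odd-q odd-p)) (≤-trans (n≤1+n _) 3+q≤m)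
        ... | true  = noClosed B∈ (uv ∷ vy ∷ P) (cong (not ∘ not) odd-p) 3+p≤m

        -- A chord `zu` leaves an odd closed walk on one side. The one through `v` is shorter only
        -- for positive `q`: otherwise `z` is `x` and the chord is the edge `xu` itself.
        apart-cycle : 0 < q → Apart B z u
        apart-cycle 0<q = ≢-cycle , chord
          where
          chord : ¬ Feasible D (toggle z (toggle u B))
          chord pzu with odd p in odd-p
          ... | false = noClosed B∈ ((≢-cycle , pzu) ∷ uv ∷ vy ∷ P) (cong (not ∘ not ∘ not) odd-p) (3+p<m 0<q)
          ... | true  = noClosed B∈ (xu ∷ Adj-sym (≢-cycle , pzu) ∷ Q)
                          (cong (not ∘ not) (odd-q odd-p)) 3+q≤m

        -- If `u` and `z` were both loops, one of the two ways round from `u` to `z` would be a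
        -- shorter odd walk between loops.
        unlooped-cycle : 0 < q → IsLoop B z → ¬ IsLoop B u
        unlooped-cycle 0<q pz pu with odd p in odd-p
        ... | false = noLooped B∈ pu pz (Adj-sym xu ∷ reverse Q) (cong not (odd-q odd-p)) 3+q≤m
        ... | true  = noLooped B∈ pu pz (uv ∷ vy ∷ P) (cong (not ∘ not) odd-p) (3+p<m 0<q)

      -- If `w` is not a loop, it serves as the loopless end for `edge∪edge`. If it is one, then `u`
      -- is not, and the roles of the edges `zw` and `uv` are swapped.
      pivot-edge : Feasible D B → Adj B x u → Adj B u v → Adj B v y → odd l ≡ false → 3 + l ≤ m →
                   Walk B y z p → Adj B z w → Walk B w x q → p + suc q ≡ l → 0 < q →
                   Adj (toggle u (toggle v B)) z w
      pivot-edge {B} {x} {u} {v} {y} {l} {z} {p} {w} {q} B∈ xu uv vy even l≤m P zw Q eq 0<q =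
        proj₁ zw , edge
        where
        zQ : Walk B z x (suc q)
        zQ = zw ∷ Q
        Pw : Walk B y w (suc p)
        Pw = snoc P zw
        eq-w : suc p + q ≡ l
        eq-w = trans (sym (+-suc p q)) eq
        reversed : ∀ {i j} → i + j ≡ l → j + i ≡ l
        reversed {i} {j} = trans (+-comm j i)
        z-u : Apart B z u
        z-u = apart-cycle B∈ xu uv vy even l≤m P zQ eq (s≤s z≤n)
        w-u : Apart B w u
        w-u = apart-cycle B∈ xu uv vy even l≤m Pw Q eq-w 0<q
        w-v : Apart B w v
        w-v = apart-cycle B∈ (Adj-sym vy) (Adj-sym uv) (Adj-sym xu) even l≤m
                (reverse Q) (reverse Pw) (reversed {suc p} eq-w) (s≤s z≤n)
        -- No more than distinctness can be asked: `z` may be `y`, a neighbour of `v`.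
        z≢v : z ≢ v
        z≢v = ≢-cycle B∈ (Adj-sym vy) (Adj-sym uv) (Adj-sym xu) even l≤m
                (reverse zQ) (reverse P) (reversed {p} eq)
        edge : Feasible D (toggle z (toggle w (toggle u (toggle v B))))
        edge with feasible? D (toggle w B)
        ... | no ¬pw = subst (Feasible D) (toggle-comm w z _)
                         (edge∪edge B∈ (Adj-sym zw) uv ¬pw w-u w-v (proj₁ z-u) z≢v)
        ... | yes pw = subst (Feasible D) (trans (toggle-rotate₄ u v z w B) (toggle-rotate₄ v z w u B))
                         (edge∪edge B∈ uv zw (unlooped-cycle B∈ xu uv vy even l≤m Pw Q eq-w 0<q pw)
                           (Apart-sym z-u) (Apart-sym w-u) (≢-sym z≢v) (≢-sym (proj₁ w-v)))

      -- The edges `xu` and `vy` cover the same four elements as `xy` and `uv`, so at the base moved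
      -- along `uv` the ends become adjacent.
      pivot-ends : Feasible D B → Adj B x u → Adj B u v → Adj B v y → ¬ IsLoop B x →
                   Apart B x v → Apart B x y → u ≢ y → Adj (toggle u (toggle v B)) x y
      pivot-ends {B} {x} {u} {v} {y} B∈ xu uv vy ¬px x-v x-y u≢y =
        proj₁ x-y , subst (Feasible D)
          (cong (toggle x) (trans (toggle-rotate u v y B) (toggle-rotate v y u B)))
          (edge∪edge B∈ xu vy ¬px x-v x-y (proj₁ uv) u≢y)

      -- Moving the base along `uv` replaces the three edges from `x` to `y` by the single edge `xy`
      -- and keeps the others. With `W` empty the walk is a triangle.
      noClosed-step : Feasible D B → Adj B x u → Adj B u v → Adj B v y → Walk B y x l →
                      odd l ≡ false → ¬ 3 + l ≤ m
      noClosed-step B∈ xu uv vy [] even l≤m = no-triangle B∈ xu uv vy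
      -- Length one for `W` contradicts `even`.
      noClosed-step {B} {x} {u} {v} {y} {l} B∈ xu uv vy W@(_ ∷ _ ∷ _) even l≤m =
        noClosed (proj₂ uv) (xy ∷ mapWalk W edge) (cong not even) (≤-trans (n≤1+n _) l≤m)
        where
        edge : ∀ {z w i j} → Walk B y z i → Adj B z w → Walk B w x j → i + suc j ≡ l →
               Adj (toggle u (toggle v B)) z w
        edge {j = suc j} P zw Q eq = pivot-edge B∈ xu uv vy even l≤m P zw Q eq (s≤s z≤n)
        -- The edge ending in `x` has nothing behind it, so it is treated on the reversed walk,
        -- where the stretch behind it is nonempty.
        edge {i = suc i} {zero} P zw Q eq =
          Adj-comm (pivot-edge B∈ (Adj-sym vy) (Adj-sym uv) (Adj-sym xu) even l≤m
            (reverse Q) (Adj-sym zw) (reverse P) (trans (+-comm 1 (suc i)) eq) (s≤s z≤n))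
        edge {i = zero} {zero} P zw Q ()
        y-u : Apart B y u
        y-u = apart-cycle B∈ xu uv vy even l≤m [] W refl (s≤s z≤n)
        x-v : Apart B x v
        x-v = apart-cycle B∈ (Adj-sym vy) (Adj-sym uv) (Adj-sym xu) even l≤m [] (reverse W) refl (s≤s z≤n)
        x-y : Apart B x y
        x-y = x≢y , λ pxy → noClosed B∈ ((x≢y , pxy) ∷ W) (cong not even) (≤-trans (n≤1+n _) l≤m)
          where
          x≢y : x ≢ y
          x≢y refl = proj₂ y-u (proj₂ xu)
        xy : Adj (toggle u (toggle v B)) x y
        xy with feasible? D (toggle x B)
        ... | no ¬px = pivot-ends B∈ xu uv vy ¬px x-v x-y (≢-sym (proj₁ y-u))
        ... | yes px = Adj-comm (pivot-ends B∈ (Adj-sym vy) (Adj-sym uv) (Adj-sym xu) ¬py y-u (Apart-sym x-y)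
                         (≢-sym (proj₁ x-v)))
          where
          ¬py : ¬ IsLoop B y
          -- This walk has weight four, which is below `m` because `l` is at least two.
          ¬py py = noLooped B∈ px py (xu ∷ uv ∷ vy ∷ []) refl (≤-trans (+-monoʳ-≤ 3 (s≤s (s≤s z≤n))) l≤m)

      -- z is a vertex of the walk a → y ⇝ z ⇝ b between the loops a and b.
      module _ (B∈ : Feasible D B) (pa : IsLoop B a) (pb : IsLoop B b) (ay : Adj B a y)
               (even : odd l ≡ false) (l≤m : 2 + l ≤ m)
               (P : Walk B y z p) (Q : Walk B z b q) (p+q≡l : p + q ≡ l) where

        private
          2+p≤m : 2 + p ≤ m
          2+p≤m = ≤-trans (+-monoʳ-≤ 2 (m+n≤o⇒m≤o p (≤-reflexive p+q≡l))) l≤m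

          2+q≤m : 2 + q ≤ m
          2+q≤m = ≤-trans (+-monoʳ-≤ 2 (m+n≤o⇒n≤o p (≤-reflexive p+q≡l))) l≤m

          2+p<m : 0 < q → 2 + p < m
          2+p<m 0<q = ≤-trans (+-monoʳ-≤ 2 (≤-trans (m<m+n p 0<q) (≤-reflexive p+q≡l))) l≤m

          2+q<m : 0 < p → 2 + q < m
          2+q<m 0<p = ≤-trans (+-monoʳ-≤ 2 (≤-trans (m<n+m q 0<p) (≤-reflexive p+q≡l))) l≤m

          odd-q : ∀ {s} → odd p ≡ s → odd q ≡ s
          odd-q = trans (sym (odd-summand p p+q≡l even))

        -- A return to `a` gives an odd closed walk, or leaves an odd walk from `a` to `b` after the
        -- return.
        ≢-path : z ≢ a
        ≢-path refl with odd p in odd-p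
        ... | false = noClosed B∈ (ay ∷ P) (cong not odd-p) 2+p≤m
        ... | true  = noLooped B∈ pa pb Q (odd-q odd-p) 2+q≤m

        unlooped-path : 0 < q → ¬ IsLoop B z
        unlooped-path 0<q pz with odd p in odd-p
        ... | false = noLooped B∈ pa pz (ay ∷ P) (cong not odd-p) (2+p<m 0<q)
        ... | true  = noLooped B∈ pz pb Q (odd-q odd-p) 2+q≤m

        -- A chord `za` is a shortcut towards `b`, shorter only for positive `p`, or closes `P` into
        -- an odd walk, shorter because `q` is then odd and hence positive.
        apart-path : 0 < p → Apart B z a
        apart-path 0<p = ≢-path , chord
          where
          chord : ¬ Feasible D (toggle z (toggle a B))
          chord pza with odd p in odd-p
          ... | false = noLooped B∈ pa pb (Adj-sym (≢-path , pza) ∷ Q) (cong not (odd-q odd-p)) (2+q<m 0<p)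
          ... | true  = noClosed B∈ ((≢-path , pza) ∷ ay ∷ P) (cong (not ∘ not) odd-p)
                          (2+p<m (odd>0 (odd-q odd-p)))

      -- At the base moved along the loop `a`, the edge `ay` and the loop `b` combine into an edge
      -- `by`, which closes `W` into an odd walk.
      noLooped-step : Feasible D B → IsLoop B a → IsLoop B b → Adj B a y → Walk B y b l →
                      odd l ≡ false → ¬ 2 + l ≤ m
      noLooped-step B∈ pa pb ab [] even l≤m = no-looped-edge B∈ ab pa pb
      noLooped-step {B} {a} {b} {y} {l} B∈ pa pb ay W@(_ ∷ _ ∷ _) even l≤m =
        noClosed pa (by ∷ mapWalk W edge) (cong not even) l≤m
        where
        apart = λ {z p q} → apart-path {z = z} {p} {q} B∈ pa pb ay even l≤m
        unlooped = λ {z p q} → unlooped-path {z = z} {p} {q} B∈ pa pb ay even l≤m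
        ≢-a = λ {z p q} → ≢-path {z = z} {p} {q} B∈ pa pb ay even l≤m
        edge : ∀ {z w i j} → Walk B y z i → Adj B z w → Walk B w b j → i + suc j ≡ l →
               Adj (toggle a B) z w
        edge {z} {w} {i} {suc j} P zw Q eq = Adj-sym (≢-sym (proj₁ zw) ,
          edge∪loop B∈ (Adj-sym zw) pa (unlooped (snoc P zw) Q eq-w (s≤s z≤n))
            (apart (snoc P zw) Q eq-w (s≤s z≤n)) (≢-a P (zw ∷ Q) eq))
          where
          eq-w : suc i + suc j ≡ l
          eq-w = trans (sym (+-suc i (suc j))) eq
        -- Now `w` is the loop `b`, so `z` has to be the loopless end.
        edge {z} {w} {suc i} {zero} P zw Q eq = proj₁ zw ,
          edge∪loop B∈ zw pa (unlooped P (zw ∷ Q) eq (s≤s z≤n))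
            (apart P (zw ∷ Q) eq (s≤s z≤n)) (≢-a (snoc P zw) Q (trans (sym (+-suc (suc i) 0)) eq))
        edge {i = zero} {zero} P zw Q ()
        ¬py : ¬ IsLoop B y
        ¬py = unlooped [] W refl (s≤s z≤n)
        y-b : Apart B y b
        y-b = (λ { refl → ¬py pb }) ,
              λ pyb → noClosed B∈ (((λ { refl → ¬py pb }) , pyb) ∷ reverse W) (cong not even) l≤m
        by : Adj (toggle a B) b y
        by = ≢-sym (proj₁ y-b) , subst (Feasible D) (trans (toggle-rotate y a b B) (toggle-rotate a b y B))
               (edge∪loop B∈ (Adj-sym ay) pb ¬py y-b (≢-sym (≢-a W [] (+-identityʳ l))))

    noOddWalks : ∀ m → NoOddClosed m × NoOddLooped m
    noOddWalks zero    = (λ _ _ _ ()) , (λ _ _ _ _ _ ())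
    noOddWalks (suc m) = step-closed , step-looped
      where
      noClosed : NoOddClosed m
      noClosed = proj₁ (noOddWalks m)
      noLooped : NoOddLooped m
      noLooped = proj₂ (noOddWalks m)
      step-closed : NoOddClosed (suc m)
      step-closed B∈ ((x≢x , _) ∷ []) _ _ = x≢x refl
      step-closed B∈ (xu ∷ uv ∷ vy ∷ W) isOdd (s≤s l≤m) =
        noClosed-step noClosed noLooped B∈ xu uv vy W (not-injective (not-injective (not-injective isOdd))) l≤m
      step-looped : NoOddLooped (suc m)
      step-looped B∈ pa pb (ay ∷ W) isOdd (s≤s l≤m) =
        noLooped-step noClosed noLooped B∈ pa pb ay W (not-injective isOdd) l≤m

    noOddClosed : Feasible D B → Walk B x x l → odd l ≢ true
    noOddClosed {l = l} B∈ W isOdd = proj₁ (noOddWalks (suc l)) B∈ W isOdd ≤-refl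

    noOddLooped : Feasible D B → IsLoop B a → IsLoop B b → Walk B a b l → odd l ≢ true
    noOddLooped {l = l} B∈ pa pb W isOdd = proj₂ (noOddWalks (suc (suc l))) B∈ pa pb W isOdd ≤-refl

-- Colourings with prescribed parities

xor-cancel : ∀ b c → b xor (b xor c) ≡ c
xor-cancel b c = trans (sym (xor-assoc b b c)) (cong (_xor c) (xor-same b))

-- R x y b prescribes the parity b between the colours of x and y, and U x b
-- the colour b of x; a consistent system closed under composition is solvable.
¬¬-colouring : (R : Fin n → Fin n → Bool → Set) (U : Fin n → Bool → Set) →
  (∀ {x y b} → R x y b → R y x b) →
  (∀ {x y z b c} → R x y b → R y z c → R x z (b xor c)) →
  (∀ {x y b c} → R x y b → U y c → U x (b xor c)) →
  (∀ {x} → ¬ R x x true) → (∀ {x} → U x true → ¬ U x false) →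
  ¬ ¬ (∃[ s ] (∀ {x y b} → R x y b → lookup s x ≡ b xor lookup s y) ×
              (∀ {x b} → U x b → lookup s x ≡ b))
¬¬-colouring {zero}  R U _ _ _ _ _ k = k ([] , (λ { {()} }) , (λ { {()} }))
¬¬-colouring {suc n} R U R-sym R-trans R-U R-irr U-irr k =
  ¬¬-colouring (λ x y → R (suc x) (suc y)) (λ x → U (suc x)) R-sym R-trans R-U R-irr U-irr extend
  where
  U-unique : ∀ {x b c} → U x b → U x c → b ≡ c
  U-unique {b = false} {false} p q = refl
  U-unique {b = false} {true}  p q = contradiction p (U-irr q)
  U-unique {b = true}  {false} p q = contradiction q (U-irr p)
  U-unique {b = true}  {true}  p q = refl

  extend : ¬ (∃[ s ] (∀ {x y b} → R (suc x) (suc y) b → lookup s x ≡ b xor lookup s y) ×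
                     (∀ {x b} → U (suc x) b → lookup s x ≡ b))
  -- The new colour is dictated by `U`, else by `R` and any one vertex already coloured, else free.
  -- `R` and `U` are not assumed decidable, hence the double negation.
  extend (s , s-R , s-U) = ¬¬-excluded-middle {A = ∃[ b ] U zero b} λ
    { (yes (b , u)) → finish b (U-unique u) λ {y} {c} r →
        trans (sym (xor-cancel c b)) (cong (c xor_) (sym (s-U (R-U (R-sym r) u))))
    ; (no ¬u) → ¬¬-excluded-middle {A = ∃[ y ] ∃[ b ] R zero (suc y) b} λ
      { (yes (y , b , r)) → finish (b xor lookup s y) (λ u → contradiction (_ , u) ¬u) λ {y′} {b′} r′ →
          trans (cong (b xor_) (trans (s-R (R-trans (R-sym r) r′)) (xor-assoc b b′ (lookup s y′))))
                (xor-cancel b _)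
      ; (no ¬r) → finish false (λ u → contradiction (_ , u) ¬u) (λ r → contradiction (_ , _ , r) ¬r)
      }
    }
    where
    finish : ∀ s₀ → (∀ {b} → U zero b → s₀ ≡ b) →
             ¬ (∀ {y b} → R zero (suc y) b → s₀ ≡ b xor lookup s y)
    finish s₀ s₀-U s₀-R = k (s₀ ∷ s , R-ok , U-ok)
      where
      R-ok : ∀ {x y b} → R x y b → lookup (s₀ ∷ s) x ≡ b xor lookup (s₀ ∷ s) y
      R-ok {zero}  {zero}  {false} r = refl
      R-ok {zero}  {zero}  {true}  r = contradiction r R-irr
      R-ok {zero}  {suc y} r = s₀-R r
      R-ok {suc x} {zero}  {b} r = trans (sym (xor-cancel b _)) (cong (b xor_) (sym (s₀-R (R-sym r))))
      R-ok {suc x} {suc y} r = s-R r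
      U-ok : ∀ {x b} → U x b → lookup (s₀ ∷ s) x ≡ b
      U-ok {zero}  u = s₀-U u
      U-ok {suc x} u = s-U u

-- Sizes of subsets

∣toggle∣-∉ : (u : Fin n) (X : Subset n) → lookup X u ≡ false → ∣ toggle u X ∣ ≡ suc ∣ X ∣
∣toggle∣-∉ zero    (false ∷ X) u∉ = refl
∣toggle∣-∉ (suc u) (true ∷ X)  u∉ = cong suc (∣toggle∣-∉ u X u∉)
∣toggle∣-∉ (suc u) (false ∷ X) u∉ = ∣toggle∣-∉ u X u∉

∣toggle∣-∈ : (u : Fin n) (X : Subset n) → lookup X u ≡ true → suc ∣ toggle u X ∣ ≡ ∣ X ∣
∣toggle∣-∈ zero    (true ∷ X)  u∈ = refl
∣toggle∣-∈ (suc u) (true ∷ X)  u∈ = cong suc (∣toggle∣-∈ u X u∈)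
∣toggle∣-∈ (suc u) (false ∷ X) u∈ = ∣toggle∣-∈ u X u∈

∣toggle∣≤ : (u : Fin n) (X : Subset n) → ∣ toggle u X ∣ ≤ suc ∣ X ∣
∣toggle∣≤ u X with lookup X u in eq
... | false = ≤-reflexive (∣toggle∣-∉ u X eq)
... | true  = ≤-trans (n≤1+n _) (≤-trans (≤-reflexive (∣toggle∣-∈ u X eq)) (n≤1+n _))

≤∣toggle∣ : (u : Fin n) (X : Subset n) → ∣ X ∣ ≤ suc ∣ toggle u X ∣
≤∣toggle∣ u X = subst (λ Y → ∣ Y ∣ ≤ suc ∣ toggle u X ∣) (toggle-involutive u X) (∣toggle∣≤ u (toggle u X))

∣△∣-disjoint : (A X : Subset n) → (∀ {x} → lookup X x ≡ true → lookup A x ≡ false) →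
               ∣ A △ X ∣ ≡ ∣ A ∣ + ∣ X ∣
∣△∣-disjoint []          []          dis = refl
∣△∣-disjoint (a ∷ A)     (false ∷ X) dis with a | ∣△∣-disjoint A X (λ {x} → dis {suc x})
... | true  | eq = cong suc eq
... | false | eq = eq
∣△∣-disjoint (true ∷ A)  (true ∷ X)  dis = contradiction (dis {zero} refl) λ ()
∣△∣-disjoint (false ∷ A) (true ∷ X)  dis =
  trans (cong suc (∣△∣-disjoint A X (λ {x} → dis {suc x}))) (sym (+-suc ∣ A ∣ ∣ X ∣))

∣△∣-⊆ : (A X : Subset n) → (∀ {x} → lookup X x ≡ true → lookup A x ≡ true) →
        ∣ A △ X ∣ + ∣ X ∣ ≡ ∣ A ∣
∣△∣-⊆ []          []          sub = refl
∣△∣-⊆ (a ∷ A)     (false ∷ X) sub with a | ∣△∣-⊆ A X (λ {x} → sub {suc x})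
... | true  | eq = cong suc eq
... | false | eq = eq
∣△∣-⊆ (true ∷ A)  (true ∷ X)  sub = trans (+-suc ∣ A △ X ∣ ∣ X ∣) (cong suc (∣△∣-⊆ A X (λ {x} → sub {suc x})))
∣△∣-⊆ (false ∷ A) (true ∷ X)  sub = contradiction (sub {zero} refl) λ ()

∣X∣≡0⇒X≡⊥ : (X : Subset n) → ∣ X ∣ ≡ 0 → X ≡ ⊥
∣X∣≡0⇒X≡⊥ []          _  = refl
∣X∣≡0⇒X≡⊥ (false ∷ X) eq = cong (false ∷_) (∣X∣≡0⇒X≡⊥ X eq)

∣X∣≤1⇒⊥-or-singleton : (X : Subset n) → ∣ X ∣ ≤ 1 → X ≡ ⊥ ⊎ (∃[ w ] X ≡ toggle w ⊥)
∣X∣≤1⇒⊥-or-singleton X ∣X∣≤1 with nonempty? X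
... | no empty = inj₁ (Empty-unique empty)
... | yes (w , w∈) = inj₂ (w , trans (sym (toggle-involutive w X)) (cong (toggle w) (∣X∣≡0⇒X≡⊥ _
        (n≤0⇒n≡0 (s≤s⁻¹ (≤-trans (≤-reflexive (∣toggle∣-∈ w X ([]=⇒lookup w∈))) ∣X∣≤1))))))

lookup-⊥ : (u : Fin n) → lookup ⊥ u ≡ false
lookup-⊥ u = lookup-replicate u false

∣X∣≡sum : (X : Subset n) → ∣ X ∣ ≡ sum (λ i → ∣ lookup X i ∷ [] ∣)
∣X∣≡sum []          = refl
∣X∣≡sum (true ∷ X)  = cong suc (∣X∣≡sum X)
∣X∣≡sum (false ∷ X) = ∣X∣≡sum X

lookup-image : (π : Permutation m n) (X : Subset m) (j : Fin n) →
               lookup (image π X) j ≡ lookup X (π ⟨$⟩ˡ j)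
lookup-image π X j = lookup∘tabulate (λ i → lookup X (π ⟨$⟩ˡ i)) j

∣image∣ : (π : Permutation m n) (X : Subset m) → ∣ image π X ∣ ≡ ∣ X ∣
∣image∣ π X = begin
  ∣ image π X ∣                                     ≡⟨ ∣X∣≡sum (image π X) ⟩
  sum (λ j → ∣ lookup (image π X) j ∷ [] ∣)         ≡⟨ sum-cong-≗ (λ j → cong (λ s → ∣ s ∷ [] ∣) (lookup-image π X j)) ⟩
  sum (λ j → ∣ lookup X (π ⟨$⟩ˡ j) ∷ [] ∣)          ≡⟨ sum-permute (λ i → ∣ lookup X i ∷ [] ∣) (Perm.flip π) ⟨
  sum (λ i → ∣ lookup X i ∷ [] ∣)                   ≡⟨ ∣X∣≡sum X ⟨
  ∣ X ∣                                             ∎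
  where open ≡-Reasoning

image-△ : (π : Permutation m n) (X Y : Subset m) → image π X △ image π Y ≡ image π (X △ Y)
image-△ π X Y = lookup-ext λ j → begin
  lookup (image π X △ image π Y) j                  ≡⟨ lookup-△ (image π X) _ j ⟩
  lookup (image π X) j xor lookup (image π Y) j     ≡⟨ cong₂ _xor_ (lookup-image π X j) (lookup-image π Y j) ⟩
  lookup X (π ⟨$⟩ˡ j) xor lookup Y (π ⟨$⟩ˡ j)       ≡⟨ lookup-△ X Y _ ⟨
  lookup (X △ Y) (π ⟨$⟩ˡ j)                         ≡⟨ lookup-image π (X △ Y) j ⟨
  lookup (image π (X △ Y)) j                        ∎
  where open ≡-Reasoning

image-flip : (π : Permutation m n) (Y : Subset n) → image π (image (Perm.flip π) Y) ≡ Y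
image-flip π Y = lookup-ext λ j →
  trans (lookup-image π (image (Perm.flip π) Y) j)
    (trans (lookup-image (Perm.flip π) Y (π ⟨$⟩ˡ j)) (cong (lookup Y) (inverseʳ π)))

-- Width at most one and its closure properties

WidthOneTwist : DeltaMatroid n → Set
WidthOneTwist D = ∃[ A ] ∃[ k ] ∀ {F} → Feasible D F → k ≤ ∣ A △ F ∣ × ∣ A △ F ∣ ≤ suc k

-- `WidthOneTwist` replaces the extrema by a bound `k` that need not be attained, so it can be
-- inherited without computing a new minimum.
width≤1⇒widthOneTwist : (D : DeltaMatroid n) (A : Subset n) → width (D * A) ≤ 1 → WidthOneTwist D
width≤1⇒widthOneTwist D A w≤1 = A , minSize (D * A) , λ {F} F∈ →
  let F∈′ = subst (Feasible D) (sym (△-cancelˡ A F)) F∈ in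
  minSize≤size (D * A) F∈′ ,
  ≤-trans (size≤maxSize (D * A) F∈′)
    (subst (maxSize (D * A) ≤_) (+-comm (minSize (D * A)) 1)
      (≤-trans (m≤n+m∸n (maxSize (D * A)) (minSize (D * A)))
               (+-monoʳ-≤ (minSize (D * A)) w≤1)))

widthOneTwist⇒width≤1 : (D : DeltaMatroid n) → WidthOneTwist D → ∃[ A ] width (D * A) ≤ 1
widthOneTwist⇒width≤1 D (A , k , bounds) with minSize-attained (D * A) | maxSize-attained (D * A)
... | X , X∈ , X≡ | Y , Y∈ , Y≡ = A , m≤n+o⇒m∸n≤o _ _ (begin
  maxSize (D * A)     ≡⟨ Y≡ ⟩
  ∣ Y ∣               ≡⟨ cong ∣_∣ (△-cancelˡ A Y) ⟨
  ∣ A △ (A △ Y) ∣     ≤⟨ proj₂ (bounds Y∈) ⟩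
  suc k               ≤⟨ s≤s (proj₁ (bounds X∈)) ⟩
  suc ∣ A △ (A △ X) ∣ ≡⟨ cong (suc ∘ ∣_∣) (△-cancelˡ A X) ⟩
  suc ∣ X ∣           ≡⟨ cong suc X≡ ⟨
  suc (minSize (D * A)) ≡⟨ +-comm 1 _ ⟩
  minSize (D * A) + 1 ∎)
  where open ≤-Reasoning

∣insertAt∣ : (X : Subset n) (e : Fin (suc n)) (s : Bool) → ∣ insertAt X e s ∣ ≡ ∣ s ∷ X ∣
∣insertAt∣ X zero s = refl
∣insertAt∣ (true ∷ X)  (suc e) true  = cong suc (∣insertAt∣ X e true)
∣insertAt∣ (true ∷ X)  (suc e) false = cong suc (∣insertAt∣ X e false)
∣insertAt∣ (false ∷ X) (suc e) true  = ∣insertAt∣ X e true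
∣insertAt∣ (false ∷ X) (suc e) false = ∣insertAt∣ X e false

-- On a slice, `e` lies in every `A △ F` or in none, so all sizes drop by the same amount, one or
-- zero.
widthOneTwist-slice : (D : DeltaMatroid (suc n)) (e : Fin (suc n)) (s : Bool) (ne : Meets D e s) →
                      WidthOneTwist D → WidthOneTwist (slice D e s ne)
widthOneTwist-slice D e s ne (A , k , bounds)
  with lookup A e xor s in eq
... | true = removeAt A e , pred k , λ {X} X∈ → shift (subst (λ z → k ≤ z × z ≤ suc k) (size X) (bounds X∈))
  where
  size : ∀ X → ∣ A △ insertAt X e s ∣ ≡ suc ∣ removeAt A e △ X ∣
  size X = trans (cong (λ Z → ∣ Z △ insertAt X e s ∣) (sym (insertAt-removeAt A e)))
    (trans (cong ∣_∣ (trans (insertAt-△ (removeAt A e) X e (lookup A e) s) (cong (insertAt _ e) eq)))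
           (∣insertAt∣ (removeAt A e △ X) e true))
  shift : ∀ {k z} → k ≤ suc z × suc z ≤ suc k → pred k ≤ z × z ≤ suc (pred k)
  -- With `k` zero every old size is one and every new size zero, so truncation by `pred` does no
  -- harm.
  shift {zero}  (_ , s≤s z≤) = z≤n , ≤-trans z≤ z≤n
  shift {suc k} (s≤s k≤ , s≤s z≤) = k≤ , z≤
... | false = removeAt A e , k , λ {X} X∈ → subst (λ z → k ≤ z × z ≤ suc k) (size X) (bounds X∈)
  where
  size : ∀ X → ∣ A △ insertAt X e s ∣ ≡ ∣ removeAt A e △ X ∣
  size X = trans (cong (λ Z → ∣ Z △ insertAt X e s ∣) (sym (insertAt-removeAt A e)))
    (trans (cong ∣_∣ (trans (insertAt-△ (removeAt A e) X e (lookup A e) s) (cong (insertAt _ e) eq)))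
           (∣insertAt∣ (removeAt A e △ X) e false))

widthOneTwist-∖ : (D : DeltaMatroid (suc n)) (e : Fin (suc n)) → WidthOneTwist D → WidthOneTwist (D ∖ e)
widthOneTwist-∖ D e with coloop? D e
... | no ¬c = widthOneTwist-slice D e false (¬coloop⇒outside D e ¬c)
... | yes c = widthOneTwist-slice D e true (coloop⇒inside D e c)

widthOneTwist-/ : (D : DeltaMatroid (suc n)) (e : Fin (suc n)) → WidthOneTwist D → WidthOneTwist (D / e)
widthOneTwist-/ D e with loop? D e
... | no ¬l = widthOneTwist-slice D e true (¬loop⇒inside D e ¬l)
... | yes l = widthOneTwist-slice D e false (loop⇒outside D e l)

widthOneTwist-≼ : {M : DeltaMatroid m} {D : DeltaMatroid n} → M ≼ D → WidthOneTwist D → WidthOneTwist M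
widthOneTwist-≼ done           w = w
widthOneTwist-≼ (delete e M≼)   w = widthOneTwist-≼ M≼ (widthOneTwist-∖ _ e w)
widthOneTwist-≼ (contract e M≼) w = widthOneTwist-≼ M≼ (widthOneTwist-/ _ e w)

widthOneTwist-≅ : {M : DeltaMatroid m} {N : DeltaMatroid n} → M ≅ N → WidthOneTwist M → WidthOneTwist N
widthOneTwist-≅ {M = M} {N} (π , iso) (A , k , bounds) = image π A , k , λ {F} F∈ →
  let X = image (Perm.flip π) F in
  subst (λ z → k ≤ z × z ≤ suc k)
    (begin
      ∣ A △ X ∣                   ≡⟨ ∣image∣ π (A △ X) ⟨
      ∣ image π (A △ X) ∣         ≡⟨ cong ∣_∣ (image-△ π A X) ⟨
      ∣ image π A △ image π X ∣   ≡⟨ cong (λ Z → ∣ image π A △ Z ∣) (image-flip π F) ⟩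
      ∣ image π A △ F ∣           ∎)
    (bounds (Equivalence.from (iso X) (subst (Feasible N) (sym (image-flip π F)) F∈)))
  where open ≡-Reasoning

widthOneTwist-* : (D : DeltaMatroid n) (A : Subset n) → WidthOneTwist (D * A) → WidthOneTwist D
widthOneTwist-* D A (C , k , bounds) = C △ A , k , λ {F} F∈ →
  subst (λ Z → k ≤ ∣ Z ∣ × ∣ Z ∣ ≤ suc k) (sym (△-assoc C A F))
    (bounds (subst (Feasible D) (sym (△-cancelˡ A F)) F∈))

-- A good twist of a twist of `D` is one of `D`, so a search through the twists of the five
-- delta-matroids is enough.
𝓓[5]⇒¬widthOneTwist : {N : DeltaMatroid n} → 𝓓[5] N → ¬ WidthOneTwist N
𝓓[5]⇒¬widthOneTwist N∈ w = by-type N∈ w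
  where
  widthOne? : (D : DeltaMatroid k) → Dec (∃[ A ] width (D * A) ≤ 1)
  widthOne? D = anySubset? λ A → width (D * A) ≤? 1
  lift : (D : DeltaMatroid k) → ¬ (∃[ A ] width (D * A) ≤ 1) → ∀ A → ¬ WidthOneTwist (D * A)
  lift D none A = none ∘ widthOneTwist⇒width≤1 D ∘ widthOneTwist-* D A
  by-type : {N : DeltaMatroid k} → 𝓓[5] N → ¬ WidthOneTwist N
  by-type (twist₁ A) = lift D₁ (from-no (widthOne? D₁)) A
  by-type (twist₂ A) = lift D₂ (from-no (widthOne? D₂)) A
  by-type (twist₃ A) = lift D₃ (from-no (widthOne? D₃)) A
  by-type (twist₄ A) = lift D₄ (from-no (widthOne? D₄)) A
  by-type (twist₅ A) = lift D₅ (from-no (widthOne? D₅)) A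

-- From a colouring to a twist of width at most one

triple⇒single : (R : DeltaMatroid 3) → Feasible R (O ∷ O ∷ O ∷ []) → Feasible R (I ∷ I ∷ I ∷ []) →
                ¬ Feasible R (I ∷ I ∷ O ∷ []) → ¬ Feasible R (I ∷ O ∷ I ∷ []) →
                Feasible R (I ∷ O ∷ O ∷ [])
-- From ∅ towards the triple, exchange at `0F` reaches only {0}, {0, 1} or {0, 2}.
triple⇒single R p∅ p012 ¬p01 ¬p02 with exchange R p∅ p012 {0F} here
... | 0F , _ , p = p
... | 1F , _ , p = contradiction p ¬p01
... | 2F , _ , p = contradiction p ¬p02

lookup-△-∉ : (A : Subset n) {X : Subset n} {u : Fin n} → lookup X u ≡ false →
             lookup (A △ X) u ≡ lookup A u
lookup-△-∉ A {X} {u} u∉ =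
  trans (lookup-△ A X u) (trans (cong (lookup A u xor_) u∉) (Bool.xor-identityʳ _))

second∈ : {F F′ : Subset n} {u v : Fin n} → F ≡ toggle u (toggle v F′) → u ≢ v →
          lookup F′ v ≡ false → lookup F v ≡ true
second∈ {F′ = F′} {v = v} refl u≢v v∉ =
  trans (lookup-toggle-≢ (≢-sym u≢v) (toggle v F′)) (trans (lookup-toggle v F′) (cong not v∉))

△-identityʳ : (X : Subset n) → X △ ⊥ ≡ X
△-identityʳ X = trans (△-comm X ⊥) (△-identityˡ X)

module _ (D : DeltaMatroid n) (∅∈ : Feasible D ⊥) where

  -- The outcome of exchange at `u` from `F` towards ∅. Writing `F` in terms of `rest` allows `F` to
  -- be eliminated by matching on `refl`.
  record Removal (F : Subset n) (u : Fin n) : Set where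
    constructor removal
    field
      {rest}   : Subset n
      feasible : Feasible D rest
      u∉rest   : lookup rest u ≡ false
      shape    : F ≡ toggle u rest ⊎
                 (∃[ v ] u ≢ v × lookup rest v ≡ false × F ≡ toggle u (toggle v rest))

  ∣rest∣< : ∀ {F u} (r : Removal F u) → ∣ Removal.rest r ∣ < ∣ F ∣
  ∣rest∣< {u = u} (removal {F′} _ u∉ (inj₁ refl)) = ≤-reflexive (sym (∣toggle∣-∉ u F′ u∉))
  ∣rest∣< {u = u} (removal {F′} _ u∉ (inj₂ (v , u≢v , v∉ , refl))) = begin-strict
    ∣ F′ ∣                     <⟨ n<1+n _ ⟩
    suc ∣ F′ ∣                 ≡⟨ ∣toggle∣-∉ v F′ v∉ ⟨
    ∣ toggle v F′ ∣            <⟨ n<1+n _ ⟩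
    suc ∣ toggle v F′ ∣        ≡⟨ ∣toggle∣-∉ u (toggle v F′) (trans (lookup-toggle-≢ u≢v F′) u∉) ⟨
    ∣ toggle u (toggle v F′) ∣ ∎
    where open ≤-Reasoning

  remove : ∀ {F u} → Feasible D F → lookup F u ≡ true → Removal F u
  remove {F} {u} F∈ u∈ with exchange D F∈ ∅∈ {u} (subst (u ∈_) (sym (△-identityʳ F)) (lookup⇒[]= u F u∈))
  ... | v , v∈ , Z∈ with u Fin.≟ v
  ...   | yes refl = removal (subst (Feasible D) (△-⁅⁆∪⁅⁆-≡ F u) Z∈)
                       (trans (lookup-toggle u F) (cong not u∈))
                       (inj₁ (sym (toggle-involutive u F)))
  ...   | no u≢v = removal (subst (Feasible D) (△-⁅⁆∪⁅⁆-≢ F u≢v) Z∈)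
                     (trans (lookup-toggle u (toggle v F)) (cong not (trans (lookup-toggle-≢ u≢v F) u∈)))
                     (inj₂ (v , u≢v , v∉ , F≡))
    where
    v∉ : lookup (toggle u (toggle v F)) v ≡ false
    v∉ = trans (lookup-toggle-≢ (≢-sym u≢v) (toggle v F)) (trans (lookup-toggle v F)
           (cong not ([]=⇒lookup (subst (v ∈_) (△-identityʳ F) v∈))))
    F≡ : F ≡ toggle u (toggle v (toggle u (toggle v F)))
    F≡ = sym (trans (cong (toggle u) (trans (cong (toggle v) (toggle-comm u v F))
           (toggle-involutive v (toggle u F)))) (toggle-involutive u F))

  ∈-rest : ∀ {F u} (r : Removal F u) {x} → lookup (Removal.rest r) x ≡ true → lookup F x ≡ true
  ∈-rest {u = u} (removal {F′} _ u∉ (inj₁ refl)) {x} x∈ = trans (lookup-toggle-≢ x≢u F′) x∈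
    where
    x≢u : x ≢ u
    x≢u refl = contradiction (trans (sym x∈) u∉) λ ()
  ∈-rest {u = u} (removal {F′} _ u∉ (inj₂ (v , u≢v , v∉ , refl))) {x} x∈ =
    trans (lookup-toggle-≢ x≢u (toggle v F′)) (trans (lookup-toggle-≢ x≢v F′) x∈)
    where
    x≢u : x ≢ u
    x≢u refl = contradiction (trans (sym x∈) u∉) λ ()
    x≢v : x ≢ v
    x≢v refl = contradiction (trans (sym x∈) v∉) λ ()

  module _ (free : Free D) (A : Subset n)
           (edge : ∀ {u v} → Adj D ⊥ u v → lookup A u ≢ lookup A v)
           (loop : ∀ {u} → Feasible D (toggle u ⊥) → lookup A u ≡ false) where

    Balanced : Subset n → Set
    Balanced F = ∣ A ∣ ≤ ∣ A △ F ∣ × ∣ A △ F ∣ ≤ suc ∣ A ∣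

    same-side⇒infeasible : ∀ {u v} → u ≢ v → lookup A u ≡ lookup A v →
                           ¬ Feasible D (toggle u (toggle v ⊥))
    same-side⇒infeasible u≢v same p = edge (u≢v , p) same

    A△toggle₂ : ∀ u v F → A △ toggle u (toggle v F) ≡ toggle u (toggle v (A △ F))
    A△toggle₂ u v F = trans (△-toggle u A (toggle v F)) (cong (toggle u) (△-toggle v A F))

    -- Losing `u` from outside `A` lowers the size of `A △ F` by one, and a second lost element
    -- raises it by at most one. `lower` is dual.
    raise : ∀ {F u} (r : Removal F u) → lookup A u ≡ false → ∣ A △ Removal.rest r ∣ ≤ ∣ A △ F ∣
    raise {u = u} (removal {F′} _ u∉ (inj₁ refl)) u∉A = begin
      ∣ A △ F′ ∣            ≤⟨ n≤1+n _ ⟩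
      suc ∣ A △ F′ ∣        ≡⟨ ∣toggle∣-∉ u (A △ F′) (trans (lookup-△-∉ A u∉) u∉A) ⟨
      ∣ toggle u (A △ F′) ∣ ≡⟨ cong ∣_∣ (△-toggle u A F′) ⟨
      ∣ A △ toggle u F′ ∣   ∎
      where open ≤-Reasoning
    raise {u = u} (removal {F′} _ u∉ (inj₂ (v , u≢v , v∉ , refl))) u∉A = begin
      ∣ A △ F′ ∣                       ≤⟨ ≤∣toggle∣ v (A △ F′) ⟩
      suc ∣ toggle v (A △ F′) ∣        ≡⟨ ∣toggle∣-∉ u (toggle v (A △ F′))
                                            (trans (lookup-toggle-≢ u≢v (A △ F′)) (trans (lookup-△-∉ A u∉) u∉A)) ⟨
      ∣ toggle u (toggle v (A △ F′)) ∣ ≡⟨ cong ∣_∣ (A△toggle₂ u v F′) ⟨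
      ∣ A △ toggle u (toggle v F′) ∣   ∎
      where open ≤-Reasoning

    lower : ∀ {F u} (r : Removal F u) → lookup A u ≡ true → ∣ A △ F ∣ ≤ ∣ A △ Removal.rest r ∣
    lower {u = u} (removal {F′} _ u∉ (inj₁ refl)) u∈A = begin
      ∣ A △ toggle u F′ ∣       ≡⟨ cong ∣_∣ (△-toggle u A F′) ⟩
      ∣ toggle u (A △ F′) ∣     ≤⟨ n≤1+n _ ⟩
      suc ∣ toggle u (A △ F′) ∣ ≡⟨ ∣toggle∣-∈ u (A △ F′) (trans (lookup-△-∉ A u∉) u∈A) ⟩
      ∣ A △ F′ ∣                ∎
      where open ≤-Reasoning
    lower {u = u} (removal {F′} _ u∉ (inj₂ (v , u≢v , v∉ , refl))) u∈A = s≤s⁻¹ (begin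
      suc ∣ A △ toggle u (toggle v F′) ∣   ≡⟨ cong (suc ∘ ∣_∣) (A△toggle₂ u v F′) ⟩
      suc ∣ toggle u (toggle v (A △ F′)) ∣ ≡⟨ ∣toggle∣-∈ u (toggle v (A △ F′))
                                                (trans (lookup-toggle-≢ u≢v (A △ F′)) (trans (lookup-△-∉ A u∉) u∈A)) ⟩
      ∣ toggle v (A △ F′) ∣                ≤⟨ ∣toggle∣≤ v (A △ F′) ⟩
      suc ∣ A △ F′ ∣                       ∎)
      where open ≤-Reasoning

    -- Inside `A`, a balanced rest must be empty; then `F` is a loop in `A` or an edge within `A`.
    ⊆A⇒¬balanced : ∀ {F u} → Feasible D F → (∀ {x} → lookup F x ≡ true → lookup A x ≡ true) →
                   lookup F u ≡ true → (r : Removal F u) → ¬ Balanced (Removal.rest r)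
    ⊆A⇒¬balanced {F} {u} F∈ F⊆A u∈ r@(removal {F′} F′∈ u∉ shape) (≥∣A∣ , _) = absurd shape
      where
      F′≡⊥ : F′ ≡ ⊥
      F′≡⊥ = ∣X∣≡0⇒X≡⊥ F′ (n≤0⇒n≡0 (+-cancelˡ-≤ ∣ A △ F′ ∣ _ _ (begin
        ∣ A △ F′ ∣ + ∣ F′ ∣ ≡⟨ ∣△∣-⊆ A F′ (λ x∈ → F⊆A (∈-rest r x∈)) ⟩
        ∣ A ∣               ≤⟨ ≥∣A∣ ⟩
        ∣ A △ F′ ∣          ≡⟨ +-identityʳ _ ⟨
        ∣ A △ F′ ∣ + 0      ∎)))
        where open ≤-Reasoning
      absurd : ¬ (F ≡ toggle u F′ ⊎
                  (∃[ v ] u ≢ v × lookup F′ v ≡ false × F ≡ toggle u (toggle v F′)))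
      absurd (inj₁ F≡) = contradiction (trans (sym (F⊆A u∈)) (loop (subst (Feasible D)
        (trans F≡ (cong (toggle u) F′≡⊥)) F∈))) λ ()
      absurd (inj₂ (v , u≢v , v∉ , F≡)) =
        same-side⇒infeasible u≢v (trans (F⊆A u∈) (sym (F⊆A (second∈ F≡ u≢v v∉))))
          (subst (Feasible D) (trans F≡ (cong (toggle u ∘ toggle v) F′≡⊥)) F∈)

    -- Outside `A`, a balanced rest has at most one element, so `F` has at most three. One element
    -- is not too big, and two elements would form an edge on one side.
    disjoint⇒¬balanced : ∀ {F u} → Feasible D F → (∀ {x} → lookup F x ≡ true → lookup A x ≡ false) →
                         ¬ ∣ A △ F ∣ ≤ suc ∣ A ∣ →
                         lookup F u ≡ true → (r : Removal F u) → ¬ Balanced (Removal.rest r)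
    disjoint⇒¬balanced {F} {u} F∈ F∩A big u∈ r@(removal {F′} F′∈ u∉ shape) (_ , ≤1+∣A∣) =
      absurd (∣X∣≤1⇒⊥-or-singleton F′ (+-cancelˡ-≤ ∣ A ∣ _ _ (begin
        ∣ A ∣ + ∣ F′ ∣ ≡⟨ ∣△∣-disjoint A F′ (λ x∈ → F∩A (∈-rest r x∈)) ⟨
        ∣ A △ F′ ∣     ≤⟨ ≤1+∣A∣ ⟩
        suc ∣ A ∣      ≡⟨ +-comm 1 ∣ A ∣ ⟩
        ∣ A ∣ + 1      ∎))) shape
      where
      open ≤-Reasoning
      infeasible : ∀ {x y} → x ≢ y → lookup F x ≡ true → lookup F y ≡ true →
                   ¬ Feasible D (toggle x (toggle y ⊥))
      infeasible x≢y x∈ y∈ = same-side⇒infeasible x≢y (trans (F∩A x∈) (sym (F∩A y∈)))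
      absurd : F′ ≡ ⊥ ⊎ (∃[ w ] F′ ≡ toggle w ⊥) →
               ¬ (F ≡ toggle u F′ ⊎
                  (∃[ v ] u ≢ v × lookup F′ v ≡ false × F ≡ toggle u (toggle v F′)))
      absurd (inj₁ refl) (inj₁ refl) = big (begin
        ∣ A △ toggle u ⊥ ∣   ≡⟨ cong ∣_∣ (△-toggle u A ⊥) ⟩
        ∣ toggle u (A △ ⊥) ∣ ≤⟨ ∣toggle∣≤ u (A △ ⊥) ⟩
        suc ∣ A △ ⊥ ∣        ≡⟨ cong (suc ∘ ∣_∣) (△-identityʳ A) ⟩
        suc ∣ A ∣            ∎)
      absurd (inj₁ refl) (inj₂ (v , u≢v , v∉ , F≡)) =
        infeasible u≢v u∈ (second∈ F≡ u≢v v∉) (subst (Feasible D) F≡ F∈)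
      absurd (inj₂ (w , refl)) (inj₁ F≡) =
        infeasible u≢w u∈ (∈-rest r w∈) (subst (Feasible D) F≡ F∈)
        where
        w∈ : lookup (toggle w ⊥) w ≡ true
        w∈ = trans (lookup-toggle w ⊥) (cong not (lookup-⊥ w))
        u≢w : u ≢ w
        u≢w refl = contradiction (trans (sym w∈) u∉) λ ()
      -- All pairs in the triple are infeasible, {w} is the rest itself, and exchange yields {u} and
      -- {v}: this is `D₂`.
      absurd (inj₂ (w , refl)) (inj₂ (v , u≢v , v∉ , F≡)) =
        no-D₂ D free ∅∈ u≢v u≢w v≢w
          (triple⇒single (local D ∅∈ (unique₃ D u≢v u≢w v≢w)) ∅∈ puvw
            (infeasible u≢v u∈ v∈) (infeasible u≢w u∈ w∈F))
          (triple⇒single (local D ∅∈ (unique₃ D (≢-sym u≢v) v≢w u≢w)) ∅∈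
            (subst (Feasible D) (toggle-comm u v (toggle w ⊥)) puvw)
            (infeasible (≢-sym u≢v) v∈ u∈) (infeasible v≢w v∈ w∈F))
          F′∈ puvw
        where
        puvw : Feasible D (toggle u (toggle v (toggle w ⊥)))
        puvw = subst (Feasible D) F≡ F∈
        v∈ : lookup F v ≡ true
        v∈ = second∈ F≡ u≢v v∉
        w∈ : lookup (toggle w ⊥) w ≡ true
        w∈ = trans (lookup-toggle w ⊥) (cong not (lookup-⊥ w))
        w∈F : lookup F w ≡ true
        w∈F = ∈-rest r w∈
        u≢w : u ≢ w
        u≢w refl = contradiction (trans (sym w∈) u∉) λ ()
        v≢w : v ≢ w
        v≢w refl = contradiction (trans (sym w∈) v∉) λ ()

    -- Induction on size. If `A △ F` is too small, an element of `F` outside `A` could be removed to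
    -- leave a smaller violation, so `F` lies in `A`; if it is too big, `F` is likewise disjoint
    -- from `A`.
    balanced : ∀ m F → ∣ F ∣ < m → Feasible D F → Balanced F
    balanced (suc m) F (s≤s ∣F∣≤m) F∈ with nonempty? F
    ... | no empty = subst Balanced (sym (Empty-unique empty))
                       (subst (λ X → ∣ A ∣ ≤ ∣ X ∣ × ∣ X ∣ ≤ suc ∣ A ∣) (sym (△-identityʳ A)) (≤-refl , n≤1+n _))
    ... | yes (u , u∈F) = low , high
      where
      u∈ : lookup F u ≡ true
      u∈ = []=⇒lookup u∈F
      rest-balanced : ∀ {x} (r : Removal F x) → Balanced (Removal.rest r)
      rest-balanced r = balanced m _ (≤-trans (∣rest∣< r) ∣F∣≤m) (Removal.feasible r)
      r₀ : Removal F u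
      r₀ = remove F∈ u∈
      low : ∣ A ∣ ≤ ∣ A △ F ∣
      low = decidable-stable (_ ≤? _) λ small →
        ⊆A⇒¬balanced F∈
          (λ {x} x∈ → decidable-stable (lookup A x Bool.≟ true) λ x∉A →
            let r = remove F∈ x∈ in
            small (≤-trans (proj₁ (rest-balanced r)) (raise r (Bool.¬-not x∉A))))
          u∈ r₀ (rest-balanced r₀)
      high : ∣ A △ F ∣ ≤ suc ∣ A ∣
      high = decidable-stable (_ ≤? _) λ big →
        disjoint⇒¬balanced F∈
          (λ {x} x∈ → decidable-stable (lookup A x Bool.≟ false) λ x∈A →
            let r = remove F∈ x∈ in
            big (≤-trans (lower r (Bool.¬-not x∈A)) (proj₂ (rest-balanced r))))
          big u∈ r₀ (rest-balanced r₀)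

  -- The colour of a vertex is the parity of its walks to loops, or in a component without loops one
  -- side of a bipartition. Absence of the two kinds of odd walk is exactly consistency, and `A`
  -- consists of the vertices coloured `true`.
  free⇒¬¬widthOneTwist : Free D → ¬ ¬ WidthOneTwist D
  free⇒¬¬widthOneTwist free k =
    ¬¬-colouring R U R-sym R-trans R-U
      (λ { (l , W , isOdd) → noOddClosed D free ∅∈ W isOdd })
      (λ { (a , pa , r) (b , pb , r′) → let l , W , isOdd = R-trans (R-sym r) r′ in
           noOddLooped D free ∅∈ pa pb W isOdd })
      (λ { (A , A-R , A-U) → k (A , ∣ A ∣ , balanced free A
             (λ {u} {v} uv same → Bool.not-¬ same (A-R (1 , uv ∷ [] , refl)))
             (λ pu → A-U (_ , pu , 0 , [] , refl)) _ _ ≤-refl) })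
    where
    R : Fin n → Fin n → Bool → Set
    R x y b = ∃[ l ] Walk D ⊥ x y l × odd l ≡ b
    U : Fin n → Bool → Set
    U x b = ∃[ a ] Feasible D (toggle a ⊥) × R x a b
    R-sym : ∀ {x y b} → R x y b → R y x b
    R-sym (l , W , eq) = l , reverse D W , eq
    R-trans : ∀ {x y z b c} → R x y b → R y z c → R x z (b xor c)
    R-trans (l , W , refl) (l′ , W′ , refl) = _ , _++ʷ_ D W W′ , odd-+ l l′
    R-U : ∀ {x y b c} → R x y b → U y c → U x (b xor c)
    R-U r (a , pa , r′) = a , pa , R-trans r r′

-- The excluded-minor characterisation

excluded-minor-free⇒free : (D : DeltaMatroid n) (A : Subset n) →
  ¬ (∃[ m ] Σ[ M ∈ DeltaMatroid m ] M ≼ D × (∃[ k ] Σ[ N ∈ DeltaMatroid k ] 𝓓[5] N × M ≅ N)) →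
  Free (D * A)
excluded-minor-free⇒free D A none {k} N excluded {xs} uniq B same =
  let m , M , M≼ , M≅ = minor in none (m , M , M≼ , k , N * C , excluded C , M≅)
  where
  B′ = A △ B
  -- A minor records traces on `xs`, not differences from `B′`; the trace of `B′` is therefore the
  -- twist to apply to `N`.
  C = tabulate (lookup B′ ∘ lookup xs)
  same′ : ∀ S → Feasible D (flip xs B′ S) ⇔ Feasible N S
  same′ S = subst (λ X → Feasible D X ⇔ Feasible N S) (△-flip xs A B S) (same S)
  minor : ∃[ m ] Σ[ M ∈ DeltaMatroid m ] M ≼ D × M ≅ N * C
  -- `B′` may be infeasible, so the base is its flip by a feasible set of `N`, which agrees with it
  -- off `xs`.
  minor = ≼-local D {N = N * C} (lookup xs) (lookup-injective uniq _ _) (flip xs B′ S₀)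
            (Equivalence.from (same′ S₀) (proj₂ (nonempty N))) λ X agree →
          subst (λ Y → Feasible D Y ⇔ Feasible N (C △ tabulate (lookup X ∘ lookup xs)))
            (flip-lookup uniq B′ X λ e e∉ → trans (agree e e∉) (lookup-flip-∉ xs B′ S₀ e∉))
            (same′ _)
    where S₀ = proj₁ (nonempty N)

theorem1p3 : ∀ {n : ℕ} (D : DeltaMatroid n) →
    (∃[ A ] width (D * A) ≤ 1)
    ⇔
    (¬ (∃[ m ] Σ[ M ∈ DeltaMatroid m ] M ≼ D ×
    (∃[ k ] Σ[ N ∈ DeltaMatroid k ] 𝓓[5] N × M ≅ N)))
theorem1p3 D = mk⇔
  (λ { (A , w≤1) (_ , M , M≼ , _ , N , N∈ , M≅) →
       𝓓[5]⇒¬widthOneTwist N∈ (widthOneTwist-≅ {M = M} {N} M≅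
         (widthOneTwist-≼ M≼ (width≤1⇒widthOneTwist D A w≤1))) })
  -- Whether a good twist exists is decidable, which removes the double negation. Twisting by the
  -- feasible set `F` makes ∅ feasible.
  (λ none → decidable-stable (anySubset? λ A → width (D * A) ≤? 1) λ wide →
    free⇒¬¬widthOneTwist (D * F)
      (subst (Feasible D) (sym (△-identityʳ F)) F∈)
      (excluded-minor-free⇒free D F none)
      (wide ∘ widthOneTwist⇒width≤1 D ∘ widthOneTwist-* D F))
  where
  F = proj₁ (nonempty D)
  F∈ = proj₂ (nonempty D)
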